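{- Let $a,b,c\in\mathbb{C}$ with $a\neq 0$ and $b^2-4ac\neq 0$, and let $r_1,r_2$ be the two distinct complex roots of $f(x)=ax^2+bx+c$. For each integer $n\geq 0$ define polynomials $P_n,Q_n\in\mathbb{C}[x]$ by $$P_n(x)=\frac{a^{2^n-1}}{r_1-r_2}\left(r_1(x-r_2)^{2^n}-r_2(x-r_1)^{2^n}\right),\qquad Q_n(x)=\frac{a^{2^n-1}}{r_1-r_2}\left((x-r_2)^{2^n}-(x-r_1)^{2^n}\right).$$ Then for every integer $n\geq 0$, $$P_n(x)=a^{2^n-1}x^{2^n}-\sum_{k=0}^{2^n-2}\ \sum_{j=0}^{2^n-k-2}(-1)^j\binom{2^n}{k}\binom{2^n-k-j-2}{j}a^{k+j}b^{2^n-k-2j-2}c^{j+1}x^k$$ and $$Q_n(x)=\sum_{k=0}^{2^n-1}\ \sum_{j=0}^{2^n-k-1}(-1)^j\binom{2^n}{k}\binom{2^n-k-j-1}{j}a^{k+j}b^{2^n-k-2j-1}c^jx^k.$$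
   Context: Conventions: $\binom{m}{j}=0$ for integers $0\leq m<j$; a summand whose binomial coefficient is $0$ is taken to be $0$, even if the formal exponent of $b$ in it is negative (the exponent of $b$ is negative only in such summands); zeroth powers equal $1$, including $0^0=1$; empty sums are $0$. -}

module Defs where

open import Level using (0ℓ)
open import Algebra.Bundles using (CommutativeRing)
open import Algebra.Structures using (IsCommutativeRing)
open import Data.Fin.Base using (toℕ)
open import Data.List.Base using (List; []; _∷_; map)
open import Data.Nat.Base as ℕ using (ℕ; zero; suc)
import Data.Nat.Properties as ℕ
open import Data.Product.Base using (Σ; _×_; _,_; proj₁; proj₂)
open import Data.Rational.Base as ℚ using (ℚ; 0ℚ; 1ℚ; ∣_∣)
import Data.Rational.Properties as ℚ
open import Data.Rational.Solver using (module +-*-Solver)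
open import Data.Sum.Base using (_⊎_; inj₁; inj₂)
open import Function.Base using (_∘_)
open import Relation.Binary.PropositionalEquality
  using (_≡_; _≢_; refl; sym; trans; cong; cong₂; subst; subst₂)
open import Relation.Nullary using (yes; no; contradiction)

------------------------------------------------------------------------

module RationalEstimates where

  open +-*-Solver using (solve; _:=_; _:+_; _:*_; _:-_; :-_)

  +-close : ∀ x y u v ε δ → ∣ x ℚ.- u ∣ ℚ.< ε → ∣ y ℚ.- v ∣ ℚ.< δ →
            ∣ (x ℚ.+ y) ℚ.- (u ℚ.+ v) ∣ ℚ.< ε ℚ.+ δ
  +-close x y u v ε δ p q = ℚ.≤-<-trans
    (subst (λ z → ∣ z ∣ ℚ.≤ ∣ x ℚ.- u ∣ ℚ.+ ∣ y ℚ.- v ∣)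
      (solve 4 (λ x y u v → (x :- u) :+ (y :- v) := (x :+ y) :- (u :+ v)) refl x y u v)
      (ℚ.∣p+q∣≤∣p∣+∣q∣ (x ℚ.- u) (y ℚ.- v)))
    (ℚ.+-mono-< {∣ x ℚ.- u ∣} {ε} {∣ y ℚ.- v ∣} {δ} p q)

  trans-close : ∀ x y z ε δ → ∣ x ℚ.- y ∣ ℚ.< ε → ∣ y ℚ.- z ∣ ℚ.< δ →
                ∣ x ℚ.- z ∣ ℚ.< ε ℚ.+ δ
  trans-close x y z ε δ p q = subst (λ w → ∣ w ∣ ℚ.< ε ℚ.+ δ)
    (solve 3 (λ x y z → (x :+ y) :- (y :+ z) := x :- z) refl x y z)
    (+-close x y y z ε δ p q)

  sym-close : ∀ x y {ε} → ∣ x ℚ.- y ∣ ℚ.< ε → ∣ y ℚ.- x ∣ ℚ.< ε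
  sym-close x y {ε} = subst (ℚ._< ε) (trans (sym (ℚ.∣-p∣≡∣p∣ (x ℚ.- y)))
    (cong ∣_∣ (solve 2 (λ x y → :- (x :- y) := y :- x) refl x y)))

  neg-close : ∀ x y {ε} → ∣ x ℚ.- y ∣ ℚ.< ε → ∣ ℚ.- x ℚ.- (ℚ.- y) ∣ ℚ.< ε
  neg-close x y {ε} p = subst (λ w → ∣ w ∣ ℚ.< ε)
    (solve 2 (λ x y → y :- x := (:- x) :- (:- y)) refl x y) (sym-close x y p)

  refl-close : ∀ x {ε} → 0ℚ ℚ.< ε → ∣ x ℚ.- x ∣ ℚ.< ε
  refl-close x {ε} = subst (λ w → ∣ w ∣ ℚ.< ε) (sym (ℚ.+-inverseʳ x))

  bound-near : ∀ x y ε → ∣ x ℚ.- y ∣ ℚ.< ε → ∣ x ∣ ℚ.≤ ∣ y ∣ ℚ.+ ε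
  bound-near x y ε p = ℚ.≤-trans
    (subst (λ z → ∣ z ∣ ℚ.≤ ∣ y ∣ ℚ.+ ∣ x ℚ.- y ∣)
      (solve 2 (λ x y → y :+ (x :- y) := x) refl x y)
      (ℚ.∣p+q∣≤∣p∣+∣q∣ y (x ℚ.- y)))
    (ℚ.+-monoʳ-≤ ∣ y ∣ (ℚ.<⇒≤ p))

  *-bound : ∀ x y B η → 0ℚ ℚ.< B → ∣ x ∣ ℚ.≤ B → ∣ y ∣ ℚ.< η → ∣ x ℚ.* y ∣ ℚ.< B ℚ.* η
  *-bound x y B η B>0 x≤B y<η = subst (ℚ._< B ℚ.* η) (sym (ℚ.∣p*q∣≡∣p∣*∣q∣ x y))
    (ℚ.≤-<-trans
      (ℚ.*-monoʳ-≤-nonNeg ∣ y ∣ {{ℚ.∣-∣-nonNeg y}} x≤B)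
      (ℚ.*-monoʳ-<-pos B {{ℚ.positive B>0}} y<η))

  *-close : ∀ x y u v B η → 0ℚ ℚ.< B → ∣ x ∣ ℚ.≤ B → ∣ v ∣ ℚ.≤ B →
            ∣ x ℚ.- u ∣ ℚ.< η → ∣ y ℚ.- v ∣ ℚ.< η →
            ∣ x ℚ.* y ℚ.- u ℚ.* v ∣ ℚ.< B ℚ.* η ℚ.+ B ℚ.* η
  *-close x y u v B η B>0 x≤B v≤B p q = ℚ.≤-<-trans
    (subst (λ z → ∣ z ∣ ℚ.≤ ∣ x ℚ.* (y ℚ.- v) ∣ ℚ.+ ∣ v ℚ.* (x ℚ.- u) ∣)
      (solve 4 (λ x y u v → x :* (y :- v) :+ v :* (x :- u) := x :* y :- u :* v) refl x y u v)
      (ℚ.∣p+q∣≤∣p∣+∣q∣ (x ℚ.* (y ℚ.- v)) (v ℚ.* (x ℚ.- u))))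
    (ℚ.+-mono-< {∣ x ℚ.* (y ℚ.- v) ∣} {B ℚ.* η} {∣ v ℚ.* (x ℚ.- u) ∣} {B ℚ.* η}
      (*-bound x (y ℚ.- v) B η B>0 x≤B q) (*-bound v (x ℚ.- u) B η B>0 v≤B p))

  p≤p+q : ∀ p q → 0ℚ ℚ.≤ q → p ℚ.≤ p ℚ.+ q
  p≤p+q p q 0≤q = subst (ℚ._≤ p ℚ.+ q) (ℚ.+-identityʳ p) (ℚ.+-monoʳ-≤ p {0ℚ} {q} 0≤q)

  p≤q+p : ∀ p q → 0ℚ ℚ.≤ q → p ℚ.≤ q ℚ.+ p
  p≤q+p p q 0≤q = subst (p ℚ.≤_) (ℚ.+-comm p q) (p≤p+q p q 0≤q)

  +-nonNeg : ∀ p q → 0ℚ ℚ.≤ p → 0ℚ ℚ.≤ q → 0ℚ ℚ.≤ p ℚ.+ q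
  +-nonNeg p q 0≤p 0≤q = ℚ.≤-trans 0≤q (p≤q+p q p 0≤p)

  *-pos : ∀ p q → 0ℚ ℚ.< p → 0ℚ ℚ.< q → 0ℚ ℚ.< p ℚ.* q
  *-pos p q p>0 q>0 =
    ℚ.positive⁻¹ (p ℚ.* q) {{ℚ.pos*pos⇒pos p {{ℚ.positive p>0}} q {{ℚ.positive q>0}}}}

  +-pos : ∀ p q → 0ℚ ℚ.< p → 0ℚ ℚ.< q → 0ℚ ℚ.< p ℚ.+ q
  +-pos p q p>0 q>0 = ℚ.<-≤-trans p>0 (p≤p+q p q (ℚ.<⇒≤ q>0))

  half : ∀ ε → 0ℚ ℚ.< ε → 0ℚ ℚ.< ε ℚ.* ℚ.½
  half ε ε>0 = *-pos ε ℚ.½ ε>0 (ℚ.positive⁻¹ ℚ.½)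

  half+half : ∀ ε → ε ℚ.* ℚ.½ ℚ.+ ε ℚ.* ℚ.½ ≡ ε
  half+half ε = trans (sym (ℚ.*-distribˡ-+ ε ℚ.½ ℚ.½)) (ℚ.*-identityʳ ε)

  divide : ∀ ε B → 0ℚ ℚ.< ε → 0ℚ ℚ.< B →
           Σ ℚ λ η → 0ℚ ℚ.< η × B ℚ.* η ℚ.+ B ℚ.* η ≡ ε
  divide ε B ε>0 B>0 = ε ℚ.* ℚ.½ ℚ.* B⁻¹ , *-pos (ε ℚ.* ℚ.½) B⁻¹ (half ε ε>0) B⁻¹>0 , eq
    where
    instance
      posB : ℚ.Positive B
      posB = ℚ.positive B>0
      nzB : ℚ.NonZero B
      nzB = ℚ.pos⇒nonZero B
    B⁻¹ : ℚ
    B⁻¹ = ℚ.1/ B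
    B⁻¹>0 : 0ℚ ℚ.< B⁻¹
    B⁻¹>0 = ℚ.positive⁻¹ B⁻¹ {{ℚ.1/pos⇒pos B}}
    e₁ : B ℚ.* (ε ℚ.* ℚ.½ ℚ.* B⁻¹) ≡ ε ℚ.* ℚ.½
    e₁ = trans (solve 3 (λ b e i → b :* (e :* i) := e :* (b :* i)) refl B (ε ℚ.* ℚ.½) B⁻¹)
           (trans (cong (ε ℚ.* ℚ.½ ℚ.*_) (ℚ.*-inverseʳ B)) (ℚ.*-identityʳ _))
    eq : B ℚ.* (ε ℚ.* ℚ.½ ℚ.* B⁻¹) ℚ.+ B ℚ.* (ε ℚ.* ℚ.½ ℚ.* B⁻¹) ≡ ε
    eq = trans (cong₂ ℚ._+_ e₁ e₁) (half+half ε)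

  recip : ℚ → ℚ
  recip q with q ℚ.≟ 0ℚ
  ... | yes _   = 0ℚ
  ... | no  q≢0 = (ℚ.1/ q) {{ℚ.≢-nonZero q≢0}}

  recip-inverse : ∀ q → q ≢ 0ℚ → q ℚ.* recip q ≡ 1ℚ
  recip-inverse q q≢0 with q ℚ.≟ 0ℚ
  ... | yes q≡0  = contradiction q≡0 q≢0
  ... | no  q≢0′ = ℚ.*-inverseʳ q {{ℚ.≢-nonZero q≢0′}}

  away⇒≢0 : ∀ q {δ} → 0ℚ ℚ.< δ → δ ℚ.≤ ∣ q ∣ → q ≢ 0ℚ
  away⇒≢0 q δ>0 δ≤ refl = contradiction (ℚ.<-≤-trans δ>0 δ≤) (ℚ.<-irrefl refl)

  *-mono-away : ∀ p q δ ε → 0ℚ ℚ.< δ → 0ℚ ℚ.< ε → δ ℚ.≤ p → ε ℚ.≤ q → δ ℚ.* ε ℚ.≤ p ℚ.* q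
  *-mono-away p q δ ε δ>0 ε>0 δ≤p ε≤q = ℚ.≤-trans
    (ℚ.*-monoʳ-≤-nonNeg ε {{ℚ.pos⇒nonNeg ε {{ℚ.positive ε>0}}}} δ≤p)
    (ℚ.*-monoˡ-≤-nonNeg p {{ℚ.nonNegative (ℚ.≤-trans (ℚ.<⇒≤ δ>0) δ≤p)}} ε≤q)

  recip-close : ∀ x y δ ε → 0ℚ ℚ.< δ → 0ℚ ℚ.< ε → δ ℚ.≤ ∣ x ∣ → δ ℚ.≤ ∣ y ∣ →
                ∣ x ℚ.- y ∣ ℚ.< ε ℚ.* (δ ℚ.* δ) → ∣ recip x ℚ.- recip y ∣ ℚ.< ε
  recip-close x y δ ε δ>0 ε>0 δ≤x δ≤y p with ∣ recip x ℚ.- recip y ∣ ℚ.<? ε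
  ... | yes q = q
  ... | no ¬q = contradiction (ℚ.≤-<-trans le p) (ℚ.<-irrefl refl)
    where
    x≢0 = away⇒≢0 x δ>0 δ≤x
    y≢0 = away⇒≢0 y δ>0 δ≤y
    prod : (recip x ℚ.- recip y) ℚ.* (x ℚ.* y) ≡ y ℚ.- x
    prod = trans
      (solve 4 (λ i j x y → (i :- j) :* (x :* y) := y :* (x :* i) :- x :* (y :* j))
        refl (recip x) (recip y) x y)
      (cong₂ ℚ._-_ (trans (cong (y ℚ.*_) (recip-inverse x x≢0)) (ℚ.*-identityʳ y))
                   (trans (cong (x ℚ.*_) (recip-inverse y y≢0)) (ℚ.*-identityʳ x)))
    abs : ∣ recip x ℚ.- recip y ∣ ℚ.* (∣ x ∣ ℚ.* ∣ y ∣) ≡ ∣ x ℚ.- y ∣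
    abs = trans (cong (∣ recip x ℚ.- recip y ∣ ℚ.*_) (sym (ℚ.∣p*q∣≡∣p∣*∣q∣ x y)))
      (trans (sym (ℚ.∣p*q∣≡∣p∣*∣q∣ (recip x ℚ.- recip y) (x ℚ.* y)))
      (trans (cong ∣_∣ prod)
      (trans (sym (ℚ.∣-p∣≡∣p∣ (y ℚ.- x)))
             (cong ∣_∣ (solve 2 (λ x y → :- (y :- x) := x :- y) refl x y)))))
    le : ε ℚ.* (δ ℚ.* δ) ℚ.≤ ∣ x ℚ.- y ∣
    le = subst (ε ℚ.* (δ ℚ.* δ) ℚ.≤_) abs
      (*-mono-away ∣ recip x ℚ.- recip y ∣ (∣ x ∣ ℚ.* ∣ y ∣) ε (δ ℚ.* δ) ε>0 (*-pos δ δ δ>0 δ>0) (ℚ.≮⇒≥ ¬q)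
        (*-mono-away ∣ x ∣ ∣ y ∣ δ δ δ>0 δ>0 δ≤x δ≤y))

  square-away : ∀ x {δ} → 0ℚ ℚ.< δ → δ ℚ.≤ ∣ x ∣ → δ ℚ.* δ ℚ.≤ x ℚ.* x
  square-away x {δ} δ>0 δ≤x = subst (δ ℚ.* δ ℚ.≤_) (∣x∣∣x∣≡xx (ℚ.∣p∣≡p∨∣p∣≡-p x))
      (*-mono-away ∣ x ∣ ∣ x ∣ δ δ δ>0 δ>0 δ≤x δ≤x)
    where
    ∣x∣∣x∣≡xx : (∣ x ∣ ≡ x ⊎ ∣ x ∣ ≡ ℚ.- x) → ∣ x ∣ ℚ.* ∣ x ∣ ≡ x ℚ.* x
    ∣x∣∣x∣≡xx (inj₁ e) = cong₂ ℚ._*_ e e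
    ∣x∣∣x∣≡xx (inj₂ e) = trans (cong₂ ℚ._*_ e e)
      (solve 1 (λ x → (:- x) :* (:- x) := x :* x) refl x)

  0≤square : ∀ x → 0ℚ ℚ.≤ x ℚ.* x
  0≤square x with ℚ.≤-total 0ℚ x
  ... | inj₁ 0≤x = ℚ.nonNegative⁻¹ (x ℚ.* x)
        {{ℚ.nonNeg*nonNeg⇒nonNeg x {{ℚ.nonNegative 0≤x}} x {{ℚ.nonNegative 0≤x}}}}
  ... | inj₂ x≤0 = ℚ.nonNegative⁻¹ (x ℚ.* x)
        {{ℚ.nonPos*nonPos⇒nonPos x {{ℚ.nonPositive x≤0}} x {{ℚ.nonPositive x≤0}}}}

  sum-away : ∀ x y {δ} → δ ℚ.≤ x ℚ.* x ⊎ δ ℚ.≤ y ℚ.* y → δ ℚ.≤ ∣ x ℚ.* x ℚ.+ y ℚ.* y ∣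
  sum-away x y {δ} h = subst (δ ℚ.≤_)
      (sym (ℚ.0≤p⇒∣p∣≡p (+-nonNeg (x ℚ.* x) (y ℚ.* y) (0≤square x) (0≤square y)))) (below h)
    where
    below : δ ℚ.≤ x ℚ.* x ⊎ δ ℚ.≤ y ℚ.* y → δ ℚ.≤ x ℚ.* x ℚ.+ y ℚ.* y
    below (inj₁ p) = ℚ.≤-trans p (p≤p+q (x ℚ.* x) (y ℚ.* y) (0≤square y))
    below (inj₂ p) = ℚ.≤-trans p (p≤q+p (y ℚ.* y) (x ℚ.* x) (0≤square x))

------------------------------------------------------------------------
-- Reals are Cauchy sequences of rationals, and two of them are equal when
-- their difference tends to 0.

Eventually : (ℕ → Set) → Set
Eventually A = Σ ℕ λ N → ∀ n → N ℕ.≤ n → A n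

IsCauchy : (ℕ → ℚ) → Set
IsCauchy s = ∀ ε → 0ℚ ℚ.< ε →
             Σ ℕ λ N → ∀ m n → N ℕ.≤ m → N ℕ.≤ n → ∣ s m ℚ.- s n ∣ ℚ.< ε

record ℝ : Set where
  no-eta-equality
  constructor mkℝ
  field
    seq    : ℕ → ℚ
    cauchy : IsCauchy seq

open ℝ

module Real where

  open RationalEstimates

  infix  8 -_
  infixl 7 _*_
  infixl 6 _+_
  infix  4 _≈_

  record _≈_ (x y : ℝ) : Set where
    constructor mk≈
    field
      close : ∀ ε → 0ℚ ℚ.< ε → Eventually λ n → ∣ seq x n ℚ.- seq y n ∣ ℚ.< ε

  open _≈_

  -- x is bounded away from 0; the positive form of x ≉ 0, from which the
  -- reciprocal can be computed.
  record _#0 (x : ℝ) : Set where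
    constructor mk#0
    field
      δ    : ℚ
      δ>0  : 0ℚ ℚ.< δ
      away : Eventually λ n → δ ℚ.≤ ∣ seq x n ∣

  private
    left : ∀ m n {k} → m ℕ.⊔ n ℕ.≤ k → m ℕ.≤ k
    left m n = ℕ.≤-trans (ℕ.m≤m⊔n m n)

    right : ∀ m n {k} → m ℕ.⊔ n ℕ.≤ k → n ℕ.≤ k
    right m n = ℕ.≤-trans (ℕ.m≤n⊔m m n)

    bounded : ∀ x → Σ ℚ λ B → 0ℚ ℚ.< B × Eventually λ n → ∣ seq x n ∣ ℚ.≤ B
    bounded x =
      let N , h = cauchy x 1ℚ (ℚ.positive⁻¹ 1ℚ)
      in ∣ seq x N ∣ ℚ.+ 1ℚ
                , ℚ.+-mono-≤-< (ℚ.0≤∣p∣ (seq x N)) (ℚ.positive⁻¹ 1ℚ)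
                , N , λ n N≤n → bound-near (seq x n) (seq x N) 1ℚ (h n N N≤n ℕ.≤-refl)

    bounded₂ : ∀ x y → Σ ℚ λ B → 0ℚ ℚ.< B ×
               Eventually λ n → ∣ seq x n ∣ ℚ.≤ B × ∣ seq y n ∣ ℚ.≤ B
    bounded₂ x y =
      let B , B>0 , M , f = bounded x
          C , C>0 , N , g = bounded y
      in B ℚ.+ C , +-pos B C B>0 C>0 , M ℕ.⊔ N , λ n h →
          ℚ.≤-trans (f n (left M N h)) (p≤p+q B C (ℚ.<⇒≤ C>0))
        , ℚ.≤-trans (g n (right M N h)) (p≤q+p C B (ℚ.<⇒≤ B>0))

  fromℚ : ℚ → ℝ
  fromℚ q = mkℝ (λ _ → q) λ ε ε>0 → 0 , λ _ _ _ _ → refl-close q ε>0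

  _+_ : ℝ → ℝ → ℝ
  seq (x + y) n = seq x n ℚ.+ seq y n
  cauchy (x + y) ε ε>0 =
    let M , f = cauchy x (ε ℚ.* ℚ.½) (half ε ε>0)
        N , g = cauchy y (ε ℚ.* ℚ.½) (half ε ε>0)
    in M ℕ.⊔ N , λ m n h k →
      subst (∣ (seq x m ℚ.+ seq y m) ℚ.- (seq x n ℚ.+ seq y n) ∣ ℚ.<_) (half+half ε)
        (+-close (seq x m) (seq y m) (seq x n) (seq y n) (ε ℚ.* ℚ.½) (ε ℚ.* ℚ.½)
          (f m n (left M N h) (left M N k)) (g m n (right M N h) (right M N k)))

  -_ : ℝ → ℝ
  seq (- x) n = ℚ.- seq x n
  cauchy (- x) ε ε>0 =
    let N , f = cauchy x ε ε>0
    in N , λ m n h k → neg-close (seq x m) (seq x n) (f m n h k)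

  _*_ : ℝ → ℝ → ℝ
  seq (x * y) n = seq x n ℚ.* seq y n
  cauchy (x * y) ε ε>0 =
    let B , B>0 , K , b = bounded₂ x y
        η , η>0 , eq    = divide ε B ε>0 B>0
        M , f           = cauchy x η η>0
        N , g           = cauchy y η η>0
    in K ℕ.⊔ (M ℕ.⊔ N) , λ m n h k →
      let h′ = right K (M ℕ.⊔ N) h
          k′ = right K (M ℕ.⊔ N) k
      in subst (∣ seq x m ℚ.* seq y m ℚ.- seq x n ℚ.* seq y n ∣ ℚ.<_) eq
        (*-close (seq x m) (seq y m) (seq x n) (seq y n) B η B>0
          (proj₁ (b m (left K (M ℕ.⊔ N) h))) (proj₂ (b n (left K (M ℕ.⊔ N) k)))
          (f m n (left M N h′) (left M N k′)) (g m n (right M N h′) (right M N k′)))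

  recipᴿ : ∀ x → x #0 → ℝ
  seq (recipᴿ x _) n = recip (seq x n)
  cauchy (recipᴿ x (mk#0 δ δ>0 (M , a))) ε ε>0 =
    let N , f = cauchy x (ε ℚ.* (δ ℚ.* δ)) (*-pos ε (δ ℚ.* δ) ε>0 (*-pos δ δ δ>0 δ>0))
    in M ℕ.⊔ N , λ m n h k →
      recip-close (seq x m) (seq x n) δ ε δ>0 ε>0 (a m (left M N h)) (a n (left M N k))
        (f m n (right M N h) (right M N k))

  private
    eventually-≡ : ∀ {x y} → Eventually (λ n → seq x n ≡ seq y n) → x ≈ y
    eventually-≡ {x} {y} (N , e) = mk≈ λ ε ε>0 → N , λ n h →
      subst (λ q → ∣ seq x n ℚ.- q ∣ ℚ.< ε) (e n h) (refl-close (seq x n) ε>0)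

    pointwise : ∀ {x y} → (∀ n → seq x n ≡ seq y n) → x ≈ y
    pointwise e = eventually-≡ (0 , λ n _ → e n)

  ≈-trans : ∀ {x y z} → x ≈ y → y ≈ z → x ≈ z
  close (≈-trans {x} {y} {z} p q) ε ε>0 =
    let M , f = close p (ε ℚ.* ℚ.½) (half ε ε>0)
        N , g = close q (ε ℚ.* ℚ.½) (half ε ε>0)
    in M ℕ.⊔ N , λ n h →
      subst (∣ seq x n ℚ.- seq z n ∣ ℚ.<_) (half+half ε)
        (trans-close (seq x n) (seq y n) (seq z n) (ε ℚ.* ℚ.½) (ε ℚ.* ℚ.½)
          (f n (left M N h)) (g n (right M N h)))

  ≈-sym : ∀ {x y} → x ≈ y → y ≈ x
  close (≈-sym {x} {y} p) ε ε>0 =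
    let N , f = close p ε ε>0
    in N , λ n h → sym-close (seq x n) (seq y n) (f n h)

  +-cong : ∀ {x y u v} → x ≈ y → u ≈ v → x + u ≈ y + v
  close (+-cong {x} {y} {u} {v} p q) ε ε>0 =
    let M , f = close p (ε ℚ.* ℚ.½) (half ε ε>0)
        N , g = close q (ε ℚ.* ℚ.½) (half ε ε>0)
    in M ℕ.⊔ N , λ n h →
      subst (∣ (seq x n ℚ.+ seq u n) ℚ.- (seq y n ℚ.+ seq v n) ∣ ℚ.<_) (half+half ε)
        (+-close (seq x n) (seq u n) (seq y n) (seq v n) (ε ℚ.* ℚ.½) (ε ℚ.* ℚ.½)
          (f n (left M N h)) (g n (right M N h)))

  -‿cong : ∀ {x y} → x ≈ y → - x ≈ - y
  close (-‿cong {x} {y} p) ε ε>0 =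
    let N , f = close p ε ε>0
    in N , λ n h → neg-close (seq x n) (seq y n) (f n h)

  *-cong : ∀ {x y u v} → x ≈ y → u ≈ v → x * u ≈ y * v
  close (*-cong {x} {y} {u} {v} p q) ε ε>0 =
    let B , B>0 , K , b = bounded₂ x v
        η , η>0 , eq    = divide ε B ε>0 B>0
        M , f           = close p η η>0
        N , g           = close q η η>0
    in K ℕ.⊔ (M ℕ.⊔ N) , λ n h →
      let h′ = right K (M ℕ.⊔ N) h
          c  = b n (left K (M ℕ.⊔ N) h)
      in subst (∣ seq x n ℚ.* seq u n ℚ.- seq y n ℚ.* seq v n ∣ ℚ.<_) eq
        (*-close (seq x n) (seq u n) (seq y n) (seq v n) B η B>0 (proj₁ c) (proj₂ c)
          (f n (left M N h′)) (g n (right M N h′)))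

  isCommutativeRing : IsCommutativeRing _≈_ _+_ _*_ -_ (fromℚ 0ℚ) (fromℚ 1ℚ)
  isCommutativeRing = record
    { isRing = record
      { +-isAbelianGroup = record
        { isGroup = record
          { isMonoid = record
            { isSemigroup = record
              { isMagma = record
                { isEquivalence = record
                  { refl = pointwise λ _ → refl ; sym = ≈-sym ; trans = ≈-trans }
                ; ∙-cong = +-cong
                }
              ; assoc = λ x y z → pointwise λ n → ℚ.+-assoc (seq x n) (seq y n) (seq z n)
              }
            ; identity = (λ x → pointwise λ n → ℚ.+-identityˡ (seq x n))
                       , (λ x → pointwise λ n → ℚ.+-identityʳ (seq x n))
            }
          ; inverse = (λ x → pointwise λ n → ℚ.+-inverseˡ (seq x n))
                    , (λ x → pointwise λ n → ℚ.+-inverseʳ (seq x n))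
          ; ⁻¹-cong = -‿cong
          }
        ; comm = λ x y → pointwise λ n → ℚ.+-comm (seq x n) (seq y n)
        }
      ; *-cong = *-cong
      ; *-assoc = λ x y z → pointwise λ n → ℚ.*-assoc (seq x n) (seq y n) (seq z n)
      ; *-identity = (λ x → pointwise λ n → ℚ.*-identityˡ (seq x n))
                   , (λ x → pointwise λ n → ℚ.*-identityʳ (seq x n))
      ; distrib = (λ x y z → pointwise λ n → ℚ.*-distribˡ-+ (seq x n) (seq y n) (seq z n))
                , (λ x y z → pointwise λ n → ℚ.*-distribʳ-+ (seq x n) (seq y n) (seq z n))
      }
    ; *-comm = λ x y → pointwise λ n → ℚ.*-comm (seq x n) (seq y n)
    }

  recipᴿ-inverse : ∀ x (x#0 : x #0) → x * recipᴿ x x#0 ≈ fromℚ 1ℚ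
  recipᴿ-inverse x (mk#0 δ δ>0 (N , a)) = eventually-≡ (N , λ n h →
    recip-inverse (seq x n) (away⇒≢0 (seq x n) δ>0 (a n h)))

  norm-#0 : ∀ x y → x #0 ⊎ y #0 → (x * x + y * y) #0
  norm-#0 x y (inj₁ (mk#0 δ δ>0 (N , a))) = mk#0 (δ ℚ.* δ) (*-pos δ δ δ>0 δ>0)
    (N , λ n h → sum-away (seq x n) (seq y n) (inj₁ (square-away (seq x n) δ>0 (a n h))))
  norm-#0 x y (inj₂ (mk#0 δ δ>0 (N , a))) = mk#0 (δ ℚ.* δ) (*-pos δ δ δ>0 δ>0)
    (N , λ n h → sum-away (seq x n) (seq y n) (inj₂ (square-away (seq y n) δ>0 (a n h))))

ℝ-commutativeRing : CommutativeRing 0ℓ 0ℓ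
ℝ-commutativeRing = record { isCommutativeRing = Real.isCommutativeRing }

------------------------------------------------------------------------
-- R[i] for an arbitrary commutative ring R: pairs (re, im) with i² = -1

module Gaussian {c ℓ} (R : CommutativeRing c ℓ) where

  private
    module R = CommutativeRing R
  open import Algebra.Properties.Ring R.ring
    using (-1*x≈-x; -‿distribʳ-*; -‿involutive)
  open import Algebra.Solver.Ring.NaturalCoefficients.Default R.commutativeSemiring
    using (solve; _:=_; _:+_; _:*_)

  infix  4 _≈_
  infixl 7 _*_
  infixl 6 _+_
  infix  8 -_

  record Carrier : Set c where
    constructor _+i_
    field
      re : R.Carrier
      im : R.Carrier

  open Carrier public

  record _≈_ (z w : Carrier) : Set ℓ where
    constructor _,_
    field
      re≈ : re z R.≈ re w
      im≈ : im z R.≈ im w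

  _+_ _*_ : Carrier → Carrier → Carrier
  z + w = (re z R.+ re w) +i (im z R.+ im w)
  z * w = (re z R.* re w R.- im z R.* im w) +i (re z R.* im w R.+ im z R.* re w)

  -_ : Carrier → Carrier
  - z = (R.- re z) +i (R.- im z)

  0# 1# : Carrier
  0# = R.0# +i R.0#
  1# = R.1# +i R.0#

  private
    m : R.Carrier
    m = R.- R.1#

    sub : ∀ x y → x R.- y R.≈ x R.+ m R.* y
    sub x y = R.+-congˡ (R.sym (-1*x≈-x y))

    *-sub : ∀ a x y → a R.* (x R.- y) R.≈ a R.* (x R.+ m R.* y)
    *-sub a x y = R.*-congˡ (sub x y)

    sub-* : ∀ a x y → (x R.- y) R.* a R.≈ (x R.+ m R.* y) R.* a
    sub-* a x y = R.*-congʳ (sub x y)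

    comm : ∀ z w → z * w ≈ w * z
    comm (a +i b) (c +i d) =
        R.+-cong (R.*-comm a c) (R.-‿cong (R.*-comm b d))
      , R.trans (R.+-comm _ _) (R.+-cong (R.*-comm b c) (R.*-comm a d))

    assoc : ∀ z w v → (z * w) * v ≈ z * (w * v)
    assoc (a +i b) (c +i d) (e +i f) =
        R.trans (R.trans (sub _ _) (R.+-congʳ (sub-* e _ _)))
          (R.trans
            (solve 7 (λ m a b c d e f →
              (a :* c :+ m :* (b :* d)) :* e :+ m :* ((a :* d :+ b :* c) :* f) :=
              a :* (c :* e :+ m :* (d :* f)) :+ m :* (b :* (c :* f :+ d :* e)))
              R.refl m a b c d e f)
            (R.sym (R.trans (sub _ _) (R.+-congʳ (*-sub a _ _)))))
      , R.trans (R.+-congʳ (sub-* f _ _))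
          (R.trans
            (solve 7 (λ m a b c d e f →
              (a :* c :+ m :* (b :* d)) :* f :+ (a :* d :+ b :* c) :* e :=
              a :* (c :* f :+ d :* e) :+ b :* (c :* e :+ m :* (d :* f)))
              R.refl m a b c d e f)
            (R.sym (R.+-congˡ (*-sub b _ _))))

    distribˡ : ∀ z w v → z * (w + v) ≈ z * w + z * v
    distribˡ (a +i b) (c +i d) (e +i f) =
        R.trans (sub _ _)
          (R.trans
            (solve 7 (λ m a b c d e f →
              a :* (c :+ e) :+ m :* (b :* (d :+ f)) :=
              (a :* c :+ m :* (b :* d)) :+ (a :* e :+ m :* (b :* f)))
              R.refl m a b c d e f)
            (R.sym (R.+-cong (sub _ _) (sub _ _))))
      , solve 6 (λ a b c d e f →
          a :* (d :+ f) :+ b :* (c :+ e) :=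
          (a :* d :+ b :* c) :+ (a :* f :+ b :* e))
          R.refl a b c d e f

    identityˡ : ∀ z → 1# * z ≈ z
    identityˡ (a +i b) =
        R.trans (sub _ _)
          (R.trans (R.+-cong (R.*-identityˡ a) (R.trans (R.*-congˡ (R.zeroˡ b)) (R.zeroʳ m)))
            (R.+-identityʳ a))
      , R.trans (R.+-cong (R.*-identityˡ b) (R.zeroˡ a)) (R.+-identityʳ b)

    ≈-trans : ∀ {z w v} → z ≈ w → w ≈ v → z ≈ v
    ≈-trans (p , q) (p′ , q′) = R.trans p p′ , R.trans q q′

  isCommutativeRing : IsCommutativeRing _≈_ _+_ _*_ -_ 0# 1#
  isCommutativeRing = record
    { isRing = record
      { +-isAbelianGroup = record
        { isGroup = record
          { isMonoid = record
            { isSemigroup = record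
              { isMagma = record
                { isEquivalence = record
                  { refl  = R.refl , R.refl
                  ; sym   = λ (p , q) → R.sym p , R.sym q
                  ; trans = λ (p , q) (p′ , q′) → R.trans p p′ , R.trans q q′
                  }
                ; ∙-cong = λ (p , q) (p′ , q′) → R.+-cong p p′ , R.+-cong q q′
                }
              ; assoc = λ _ _ _ → R.+-assoc _ _ _ , R.+-assoc _ _ _
              }
            ; identity = (λ _ → R.+-identityˡ _ , R.+-identityˡ _)
                       , (λ _ → R.+-identityʳ _ , R.+-identityʳ _)
            }
          ; inverse = (λ _ → R.-‿inverseˡ _ , R.-‿inverseˡ _)
                    , (λ _ → R.-‿inverseʳ _ , R.-‿inverseʳ _)
          ; ⁻¹-cong = λ (p , q) → R.-‿cong p , R.-‿cong q
          }
        ; comm = λ _ _ → R.+-comm _ _ , R.+-comm _ _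
        }
      ; *-cong = λ (p , q) (p′ , q′) →
          R.+-cong (R.*-cong p p′) (R.-‿cong (R.*-cong q q′))
        , R.+-cong (R.*-cong p q′) (R.*-cong q p′)
      ; *-assoc = assoc
      ; *-identity = identityˡ , λ z → ≈-trans (comm z 1#) (identityˡ z)
      ; distrib = distribˡ , λ z w v →
          let p  , q  = distribˡ z w v
              p₁ , q₁ = comm z w
              p₂ , q₂ = comm z v
          in ≈-trans (comm (w + v) z) (R.trans p (R.+-cong p₁ p₂) , R.trans q (R.+-cong q₁ q₂))
      }
    ; *-comm = comm
    }

  commutativeRing : CommutativeRing c ℓ
  commutativeRing = record { isCommutativeRing = isCommutativeRing }

  -- the reciprocal of z, given the reciprocal d of its norm
  conj/ : Carrier → R.Carrier → Carrier
  conj/ z d = (re z R.* d) +i (R.- (im z R.* d))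

  conj/-inverse : ∀ z d → (re z R.* re z R.+ im z R.* im z) R.* d R.≈ R.1# →
                  z * conj/ z d ≈ 1#
  conj/-inverse (a +i b) d e =
      R.trans (R.+-congˡ (R.trans (R.-‿cong (R.sym (-‿distribʳ-* b _))) (-‿involutive _)))
        (R.trans
          (solve 3 (λ a b d → a :* (a :* d) :+ b :* (b :* d) := (a :* a :+ b :* b) :* d)
            R.refl a b d)
          e)
    , R.trans (R.+-congʳ (R.sym (-‿distribʳ-* a _)))
        (R.trans
          (R.+-congˡ (solve 3 (λ a b d → b :* (a :* d) := a :* (b :* d)) R.refl a b d))
          (R.-‿inverseˡ _))

------------------------------------------------------------------------
-- Polynomials over a commutative ring, as lists of coefficients (constant
-- term first) up to trailing zeros

module Polynomial {c ℓ} (R : CommutativeRing c ℓ) where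

  private
    module R = CommutativeRing R
  open import Algebra.Properties.Ring R.ring using (-0#≈0#)
  open import Algebra.Properties.CommutativeSemigroup R.+-commutativeSemigroup
    using (interchange; x∙yz≈y∙xz)
  open import Relation.Binary.Reasoning.Setoid R.setoid

  infix  4 _≈_
  infixl 7 _*_
  infixl 6 _+_
  infix  8 -_

  Poly : Set c
  Poly = List R.Carrier

  coeff : Poly → ℕ → R.Carrier
  coeff []      _       = R.0#
  coeff (a ∷ p) zero    = a
  coeff (a ∷ p) (suc k) = coeff p k

  record _≈_ (p q : Poly) : Set ℓ where
    constructor mk≈
    field
      coeff≈ : ∀ k → coeff p k R.≈ coeff q k

  open _≈_ public

  const : R.Carrier → Poly
  const a = a ∷ []

  X : Poly
  X = R.0# ∷ R.1# ∷ []

  _+_ : Poly → Poly → Poly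
  []      + q       = q
  (a ∷ p) + []      = a ∷ p
  (a ∷ p) + (b ∷ q) = (a R.+ b) ∷ (p + q)

  -_ : Poly → Poly
  -_ = map (λ a → R.- a)

  scale : R.Carrier → Poly → Poly
  scale a = map (a R.*_)

  _*_ : Poly → Poly → Poly
  []      * q = []
  (a ∷ p) * q = scale a q + (R.0# ∷ p * q)

  coeff-+ : ∀ p q k → coeff (p + q) k R.≈ coeff p k R.+ coeff q k
  coeff-+ []      q       k       = R.sym (R.+-identityˡ _)
  coeff-+ (a ∷ p) []      k       = R.sym (R.+-identityʳ _)
  coeff-+ (a ∷ p) (b ∷ q) zero    = R.refl
  coeff-+ (a ∷ p) (b ∷ q) (suc k) = coeff-+ p q k

  coeff-neg : ∀ p k → coeff (- p) k R.≈ R.- coeff p k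
  coeff-neg []      k       = R.sym -0#≈0#
  coeff-neg (a ∷ p) zero    = R.refl
  coeff-neg (a ∷ p) (suc k) = coeff-neg p k

  coeff-scale : ∀ a p k → coeff (scale a p) k R.≈ a R.* coeff p k
  coeff-scale a []      k       = R.sym (R.zeroʳ a)
  coeff-scale a (b ∷ p) zero    = R.refl
  coeff-scale a (b ∷ p) (suc k) = coeff-scale a p k

  coeff-* : ∀ a p q k →
            coeff ((a ∷ p) * q) k R.≈ a R.* coeff q k R.+ coeff (R.0# ∷ p * q) k
  coeff-* a p q k = R.trans (coeff-+ (scale a q) (R.0# ∷ p * q) k) (R.+-congʳ (coeff-scale a q k))

  private
    ≈-refl : ∀ {p} → p ≈ p
    ≈-refl = mk≈ λ _ → R.refl

    ≈-sym : ∀ {p q} → p ≈ q → q ≈ p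
    ≈-sym e = mk≈ λ k → R.sym (coeff≈ e k)

    ≈-trans : ∀ {p q r} → p ≈ q → q ≈ r → p ≈ r
    ≈-trans e f = mk≈ λ k → R.trans (coeff≈ e k) (coeff≈ f k)

    ∷-cong : ∀ {a b p q} → a R.≈ b → p ≈ q → (a ∷ p) ≈ (b ∷ q)
    coeff≈ (∷-cong e f) zero    = e
    coeff≈ (∷-cong e f) (suc k) = coeff≈ f k

    +-cong : ∀ {p q r s} → p ≈ q → r ≈ s → p + r ≈ q + s
    +-cong {p} {q} {r} {s} e f = mk≈ λ k → begin
      coeff (p + r) k           ≈⟨ coeff-+ p r k ⟩
      coeff p k R.+ coeff r k   ≈⟨ R.+-cong (coeff≈ e k) (coeff≈ f k) ⟩
      coeff q k R.+ coeff s k   ≈⟨ coeff-+ q s k ⟨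
      coeff (q + s) k           ∎

    +-assoc : ∀ p q r → (p + q) + r ≈ p + (q + r)
    +-assoc p q r = mk≈ λ k → begin
      coeff ((p + q) + r) k                   ≈⟨ coeff-+ (p + q) r k ⟩
      coeff (p + q) k R.+ coeff r k           ≈⟨ R.+-congʳ (coeff-+ p q k) ⟩
      coeff p k R.+ coeff q k R.+ coeff r k   ≈⟨ R.+-assoc _ _ _ ⟩
      coeff p k R.+ (coeff q k R.+ coeff r k) ≈⟨ R.+-congˡ (coeff-+ q r k) ⟨
      coeff p k R.+ coeff (q + r) k           ≈⟨ coeff-+ p (q + r) k ⟨
      coeff (p + (q + r)) k                   ∎

    +-comm : ∀ p q → p + q ≈ q + p
    +-comm p q = mk≈ λ k → begin
      coeff (p + q) k         ≈⟨ coeff-+ p q k ⟩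
      coeff p k R.+ coeff q k ≈⟨ R.+-comm _ _ ⟩
      coeff q k R.+ coeff p k ≈⟨ coeff-+ q p k ⟨
      coeff (q + p) k         ∎

    +-identityʳ : ∀ p → p + [] ≈ p
    +-identityʳ p = +-comm p []

    +-inverseʳ : ∀ p → p + - p ≈ []
    +-inverseʳ p = mk≈ λ k → begin
      coeff (p + - p) k           ≈⟨ coeff-+ p (- p) k ⟩
      coeff p k R.+ coeff (- p) k ≈⟨ R.+-congˡ (coeff-neg p k) ⟩
      coeff p k R.+ R.- coeff p k ≈⟨ R.-‿inverseʳ _ ⟩
      R.0#                        ∎

    -‿cong : ∀ {p q} → p ≈ q → - p ≈ - q
    -‿cong {p} {q} e = mk≈ λ k → begin
      coeff (- p) k ≈⟨ coeff-neg p k ⟩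
      R.- coeff p k ≈⟨ R.-‿cong (coeff≈ e k) ⟩
      R.- coeff q k ≈⟨ coeff-neg q k ⟨
      coeff (- q) k ∎

    scale-cong : ∀ a {p q} → p ≈ q → scale a p ≈ scale a q
    scale-cong a {p} {q} e = mk≈ λ k → begin
      coeff (scale a p) k ≈⟨ coeff-scale a p k ⟩
      a R.* coeff p k     ≈⟨ R.*-congˡ (coeff≈ e k) ⟩
      a R.* coeff q k     ≈⟨ coeff-scale a q k ⟨
      coeff (scale a q) k ∎

    0∷[] : (R.0# ∷ []) ≈ []
    coeff≈ 0∷[] zero    = R.refl
    coeff≈ 0∷[] (suc k) = R.refl

    *-congˡ : ∀ p {q r} → q ≈ r → p * q ≈ p * r
    *-congˡ []      e = ≈-refl
    *-congˡ (a ∷ p) e = +-cong (scale-cong a e) (∷-cong R.refl (*-congˡ p e))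

    *-nilʳ : ∀ p → p * [] ≈ []
    *-nilʳ []      = ≈-refl
    *-nilʳ (a ∷ p) = ≈-trans (∷-cong R.refl (*-nilʳ p)) 0∷[]

    *-consʳ : ∀ p b q → p * (b ∷ q) ≈ scale b p + (R.0# ∷ p * q)
    *-consʳ []      b q = ≈-sym 0∷[]
    coeff≈ (*-consʳ (a ∷ p) b q) zero    = R.+-congʳ (R.*-comm a b)
    coeff≈ (*-consʳ (a ∷ p) b q) (suc k) = begin
      coeff (scale a q + p * (b ∷ q)) k
        ≈⟨ coeff-+ (scale a q) (p * (b ∷ q)) k ⟩
      coeff (scale a q) k R.+ coeff (p * (b ∷ q)) k
        ≈⟨ R.+-congˡ (coeff≈ (*-consʳ p b q) k) ⟩
      coeff (scale a q) k R.+ coeff (scale b p + (R.0# ∷ p * q)) k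
        ≈⟨ R.+-congˡ (coeff-+ (scale b p) (R.0# ∷ p * q) k) ⟩
      coeff (scale a q) k R.+ (coeff (scale b p) k R.+ coeff (R.0# ∷ p * q) k)
        ≈⟨ x∙yz≈y∙xz _ _ _ ⟩
      coeff (scale b p) k R.+ (coeff (scale a q) k R.+ coeff (R.0# ∷ p * q) k)
        ≈⟨ R.+-congˡ (coeff-+ (scale a q) (R.0# ∷ p * q) k) ⟨
      coeff (scale b p) k R.+ coeff ((a ∷ p) * q) k
        ≈⟨ coeff-+ (scale b p) ((a ∷ p) * q) k ⟨
      coeff (scale b p + (a ∷ p) * q) k ∎

    *-comm : ∀ p q → p * q ≈ q * p
    *-comm []      q = ≈-sym (*-nilʳ q)
    *-comm (a ∷ p) q = ≈-trans
      (+-cong (≈-refl {scale a q}) (∷-cong R.refl (*-comm p q))) (≈-sym (*-consʳ q a p))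

    *-cong : ∀ {p q r s} → p ≈ q → r ≈ s → p * r ≈ q * s
    *-cong {p} {q} {r} {s} e f = ≈-trans (*-congˡ p f)
      (≈-trans (*-comm p s) (≈-trans (*-congˡ s e) (*-comm s q)))

    scale-+ : ∀ a p q → scale a (p + q) ≈ scale a p + scale a q
    scale-+ a p q = mk≈ λ k → begin
      coeff (scale a (p + q)) k                     ≈⟨ coeff-scale a (p + q) k ⟩
      a R.* coeff (p + q) k                         ≈⟨ R.*-congˡ (coeff-+ p q k) ⟩
      a R.* (coeff p k R.+ coeff q k)               ≈⟨ R.distribˡ _ _ _ ⟩
      a R.* coeff p k R.+ a R.* coeff q k           ≈⟨ R.+-cong (coeff-scale a p k) (coeff-scale a q k) ⟨
      coeff (scale a p) k R.+ coeff (scale a q) k   ≈⟨ coeff-+ (scale a p) (scale a q) k ⟨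
      coeff (scale a p + scale a q) k               ∎

    +-interchange : ∀ p q r s → (p + q) + (r + s) ≈ (p + r) + (q + s)
    +-interchange p q r s = ≈-trans (+-assoc p q (r + s))
      (≈-trans (+-cong (≈-refl {p}) (≈-trans (≈-sym (+-assoc q r s))
        (≈-trans (+-cong (+-comm q r) (≈-refl {s})) (+-assoc r q s))))
        (≈-sym (+-assoc p r (q + s))))

    0∷-+ : ∀ p q → (R.0# ∷ (p + q)) ≈ (R.0# ∷ p) + (R.0# ∷ q)
    0∷-+ p q = ∷-cong (R.sym (R.+-identityˡ _)) ≈-refl

    *-distribˡ : ∀ p q r → p * (q + r) ≈ p * q + p * r
    *-distribˡ []      q r = ≈-refl
    *-distribˡ (a ∷ p) q r = ≈-trans
      (+-cong (scale-+ a q r)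
        (≈-trans (∷-cong R.refl (*-distribˡ p q r)) (0∷-+ (p * q) (p * r))))
      (+-interchange (scale a q) (scale a r) (R.0# ∷ p * q) (R.0# ∷ p * r))

    *-distribʳ : ∀ p q r → (q + r) * p ≈ q * p + r * p
    *-distribʳ p q r = ≈-trans (*-comm (q + r) p)
      (≈-trans (*-distribˡ p q r) (+-cong (*-comm p q) (*-comm p r)))

    scale-scale : ∀ a b p → scale (a R.* b) p ≈ scale a (scale b p)
    scale-scale a b p = mk≈ λ k → begin
      coeff (scale (a R.* b) p) k   ≈⟨ coeff-scale (a R.* b) p k ⟩
      a R.* b R.* coeff p k         ≈⟨ R.*-assoc _ _ _ ⟩
      a R.* (b R.* coeff p k)       ≈⟨ R.*-congˡ (coeff-scale b p k) ⟨
      a R.* coeff (scale b p) k     ≈⟨ coeff-scale a (scale b p) k ⟨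
      coeff (scale a (scale b p)) k ∎

    scale-* : ∀ a p q → scale a p * q ≈ scale a (p * q)
    scale-* a []      q = ≈-refl
    scale-* a (b ∷ p) q = ≈-trans
      (+-cong (scale-scale a b q) (∷-cong (R.sym (R.zeroʳ a)) (scale-* a p q)))
      (≈-sym (scale-+ a (scale b q) (R.0# ∷ p * q)))

    scale-0 : ∀ p → scale R.0# p ≈ []
    scale-0 p = mk≈ λ k → R.trans (coeff-scale R.0# p k) (R.zeroˡ _)

    scale-1 : ∀ p → scale R.1# p ≈ p
    scale-1 p = mk≈ λ k → R.trans (coeff-scale R.1# p k) (R.*-identityˡ _)

    *-assoc : ∀ p q r → (p * q) * r ≈ p * (q * r)
    *-assoc []      q r = ≈-refl
    *-assoc (a ∷ p) q r = ≈-trans (*-distribʳ r (scale a q) (R.0# ∷ p * q))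
      (+-cong (scale-* a q r)
        (+-cong (scale-0 r) (∷-cong R.refl (*-assoc p q r))))

    *-identityˡ : ∀ p → const R.1# * p ≈ p
    *-identityˡ p = ≈-trans (+-cong (scale-1 p) 0∷[]) (+-identityʳ p)

  isCommutativeRing : IsCommutativeRing _≈_ _+_ _*_ -_ [] (const R.1#)
  isCommutativeRing = record
    { isRing = record
      { +-isAbelianGroup = record
        { isGroup = record
          { isMonoid = record
            { isSemigroup = record
              { isMagma = record
                { isEquivalence = record { refl = ≈-refl ; sym = ≈-sym ; trans = ≈-trans }
                ; ∙-cong = +-cong
                }
              ; assoc = +-assoc
              }
            ; identity = (λ _ → ≈-refl) , +-identityʳ
            }
          ; inverse = (λ p → ≈-trans (+-comm (- p) p) (+-inverseʳ p)) , +-inverseʳ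
          ; ⁻¹-cong = -‿cong
          }
        ; comm = +-comm
        }
      ; *-cong = *-cong
      ; *-assoc = *-assoc
      ; *-identity = *-identityˡ , λ p → ≈-trans (*-comm p (const R.1#)) (*-identityˡ p)
      ; distrib = *-distribˡ , *-distribʳ
      }
    ; *-comm = *-comm
    }

  commutativeRing : CommutativeRing c ℓ
  commutativeRing = record { isCommutativeRing = isCommutativeRing }

------------------------------------------------------------------------

module Complex = Gaussian ℝ-commutativeRing

open Complex public using (re; im) renaming (Carrier to ℂ)

ℂ-commutativeRing : CommutativeRing 0ℓ 0ℓ
ℂ-commutativeRing = Complex.commutativeRing

open CommutativeRing ℂ-commutativeRing public
  using (_≈_; _+_; _*_; -_; _-_; 0#; 1#)
open import Algebra.Properties.Semiring.Exp (CommutativeRing.semiring ℂ-commutativeRing) public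
  using (_^_)
open import Algebra.Properties.Monoid.Mult (CommutativeRing.+-monoid ℂ-commutativeRing)
  using () renaming (_×_ to _×ℂ_)

fromℕ : ℕ → ℂ
fromℕ m = m ×ℂ 1#

infix 4 _#0 _#_

-- Being nonzero and being distinct, in the positive form that division
-- requires constructively; classically z #0 is z ≉ 0# and z # w is z ≉ w.
_#0 : ℂ → Set
z #0 = (re z Real.#0) ⊎ (im z Real.#0)

_#_ : ℂ → ℂ → Set
z # w = (z - w) #0

∣_∣² : ℂ → ℝ
∣ z ∣² = re z Real.* re z Real.+ im z Real.* im z

∣_∣²⁻¹ : (z : ℂ) → z #0 → ℝ
∣ z ∣²⁻¹ z#0 = Real.recipᴿ ∣ z ∣² (Real.norm-#0 (re z) (im z) z#0)

recip : (z : ℂ) → z #0 → ℂ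
recip z z#0 = Complex.conj/ z (∣ z ∣²⁻¹ z#0)

recip-inverse : ∀ z (z#0 : z #0) → z * recip z z#0 ≈ 1#
recip-inverse z z#0 = Complex.conj/-inverse z (∣ z ∣²⁻¹ z#0)
  (Real.recipᴿ-inverse ∣ z ∣² (Real.norm-#0 (re z) (im z) z#0))

------------------------------------------------------------------------

module ℂ[X] = Polynomial ℂ-commutativeRing

ℂ[X] : Set
ℂ[X] = ℂ[X].Poly

ℂ[X]-commutativeRing : CommutativeRing 0ℓ 0ℓ
ℂ[X]-commutativeRing = ℂ[X].commutativeRing

open ℂ[X] public using (const; X)
open CommutativeRing ℂ[X]-commutativeRing public
  using ()
  renaming (_≈_ to _≈ₚ_; _+_ to _+ₚ_; _*_ to _*ₚ_; _-_ to _-ₚ_)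
open import Algebra.Properties.Semiring.Exp (CommutativeRing.semiring ℂ[X]-commutativeRing) public
  using () renaming (_^_ to _^ₚ_)
open import Algebra.Properties.Monoid.Sum (CommutativeRing.+-monoid ℂ[X]-commutativeRing)
  using () renaming (sum to sumₚ)

-- indexed by ℕ rather than Fin n; empty for n = 0
∑< : ℕ → (ℕ → ℂ[X]) → ℂ[X]
∑< n f = sumₚ {n} (f ∘ toℕ)

infixr 5 ∑<

syntax ∑< n (λ k → p) = ∑[ k < n ] p

------------------------------------------------------------------------

IsRoot : (a b c r : ℂ) → Set
IsRoot a b c r = a * r ^ 2 + b * r + c ≈ 0#

P Q : (a r₁ r₂ : ℂ) → r₁ # r₂ → ℕ → ℂ[X]
P a r₁ r₂ r₁#r₂ n =
  const (a ^ (2 ℕ.^ n ℕ.∸ 1) * recip (r₁ - r₂) r₁#r₂) *ₚ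
  (const r₁ *ₚ (X -ₚ const r₂) ^ₚ (2 ℕ.^ n) -ₚ const r₂ *ₚ (X -ₚ const r₁) ^ₚ (2 ℕ.^ n))
Q a r₁ r₂ r₁#r₂ n =
  const (a ^ (2 ℕ.^ n ℕ.∸ 1) * recip (r₁ - r₂) r₁#r₂) *ₚ
  ((X -ₚ const r₂) ^ₚ (2 ℕ.^ n) -ₚ (X -ₚ const r₁) ^ₚ (2 ℕ.^ n))

{-# OPTIONS --safe #-}
module Submission where

-- With v = - r₂ and w = - r₁, both roots satisfy a u² + c = b u, and Vieta gives
-- a (v + w) = b and a v w = c. Hence a^m (v^(m+1) - w^(m+1)) = (r₁ - r₂) H_m, where
-- H₀ = 1, H₁ = b and H_(m+2) = b H_(m+1) - a c H_m, and Pascal's rule gives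
-- H_m = Σ_j (-1)^j C(m-j, j) a^j b^(m-2j) c^j. The binomial theorem for (x + v)^N and
-- (x + w)^N turns Q into Σ_k C(N, k) a^k x^k H_(N-k-1). In P the term for k = N is the
-- leading one, the one for k = N-1 vanishes, and the others acquire a factor a v w = c.

open import Defs using (module Polynomial)
open import Algebra.Bundles using (CommutativeRing)
open import Algebra.Morphism.Structures using (IsRingHomomorphism)
open import Data.Fin.Base using (toℕ)
open import Data.Fin.Properties using (toℕ<n)
open import Data.Nat.Base as ℕ using (ℕ; zero; suc)
open import Data.Nat.Combinatorics using (_C_; k>n⇒nCk≡0; nCn≡1; nCk+nC[k+1]≡[n+1]C[k+1])
import Data.Nat.Properties as ℕ
open import Data.Product.Base using (_×_; _,_)
open import Function.Base using (_∘_)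
open import Relation.Binary.PropositionalEquality as ≡ using (_≡_; cong)
open import Relation.Nullary using (yes; no)

-- Truncated subtraction on the natural numbers

∸-swap : ∀ m n o → m ℕ.∸ n ℕ.∸ o ≡ m ℕ.∸ o ℕ.∸ n
∸-swap m n o = ≡.trans (ℕ.∸-+-assoc m n o)
  (≡.trans (cong (m ℕ.∸_) (ℕ.+-comm n o)) (≡.sym (ℕ.∸-+-assoc m o n)))

∸-suc : ∀ {m n} → n ℕ.< m → m ℕ.∸ n ≡ suc (m ℕ.∸ n ℕ.∸ 1)
∸-suc n<m = ≡.sym (ℕ.m+[n∸m]≡n (ℕ.m<n⇒0<n∸m n<m))

-- Used for `P`, whose terms with `k < N ∸ 1` leave an exponent `N ∸ k` of at least 2.
∸1≡suc-∸2 : ∀ {m n} → n ℕ.< m ℕ.∸ 1 → m ℕ.∸ n ℕ.∸ 1 ≡ suc (m ℕ.∸ n ℕ.∸ 2)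
∸1≡suc-∸2 {m} {n} n<m∸1 = begin
  m ℕ.∸ n ℕ.∸ 1              ≡⟨ ∸-swap m n 1 ⟩
  m ℕ.∸ 1 ℕ.∸ n              ≡⟨ ∸-suc n<m∸1 ⟩
  suc (m ℕ.∸ 1 ℕ.∸ n ℕ.∸ 1)  ≡⟨ cong (λ i → suc (i ℕ.∸ 1)) (∸-swap m 1 n) ⟩
  suc (m ℕ.∸ n ℕ.∸ 1 ℕ.∸ 1)  ≡⟨ cong suc (ℕ.∸-+-assoc (m ℕ.∸ n) 1 1) ⟩
  suc (m ℕ.∸ n ℕ.∸ 2)        ∎
  where open ≡.≡-Reasoning

∸-2*suc : ∀ m j → 1 ℕ.+ m ℕ.∸ 2 ℕ.* suc j ≡ m ℕ.∸ j ℕ.∸ j ℕ.∸ 1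
∸-2*suc m j = begin
  m ℕ.∸ (j ℕ.+ suc (j ℕ.+ 0))  ≡⟨ ℕ.∸-+-assoc m j _ ⟨
  m ℕ.∸ j ℕ.∸ suc (j ℕ.+ 0)    ≡⟨ cong (λ i → m ℕ.∸ j ℕ.∸ i) (ℕ.+-comm 1 (j ℕ.+ 0)) ⟩
  m ℕ.∸ j ℕ.∸ (j ℕ.+ 0 ℕ.+ 1)  ≡⟨ cong (λ i → m ℕ.∸ j ℕ.∸ (i ℕ.+ 1)) (ℕ.+-identityʳ j) ⟩
  m ℕ.∸ j ℕ.∸ (j ℕ.+ 1)        ≡⟨ ℕ.∸-+-assoc (m ℕ.∸ j) j 1 ⟨
  m ℕ.∸ j ℕ.∸ j ℕ.∸ 1          ∎
  where open ≡.≡-Reasoning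

∸-2* : ∀ m j → m ℕ.∸ 2 ℕ.* j ≡ m ℕ.∸ j ℕ.∸ j
∸-2* m j = ≡.trans (cong (λ i → m ℕ.∸ (j ℕ.+ i)) (ℕ.+-identityʳ j)) (≡.sym (ℕ.∸-+-assoc m j j))

-- Finite sums and the binomial theorem in a commutative ring

module Expansion {c ℓ} (R : CommutativeRing c ℓ) where

  open CommutativeRing R
  open import Algebra.Properties.Semiring.Exp semiring using (_^_; ^-homo-*; ^-congʳ)
  open import Algebra.Properties.Semiring.Mult semiring
    using (×-congʳ; ×-assoc-*; ×-homo-+) renaming (_×_ to _×ᵣ_)
  open import Algebra.Properties.Semiring.Sum semiring
    using (sum; sum-cong-≋; *-distribˡ-sum; ∑-distrib-+)
  open import Algebra.Properties.Ring ring
    using (+-cancelˡ; +-cancelʳ; -‿distribˡ-*; -‿distribʳ-*; -‿involutive)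
  open import Algebra.Properties.CommutativeSemiring.Binomial commutativeSemiring
    using () renaming (theorem to binomialTheorem)
  open import Algebra.Solver.Ring.NaturalCoefficients.Default commutativeSemiring
    using (solve; _:=_; _:+_; _:*_; con)
  open import Relation.Binary.Reasoning.Setoid setoid

  -- Over ℂ[X] this unfolds to the same sum as `∑<`, so the expansions apply to the theorem without
  -- conversion.
  sumTo : ℕ → (ℕ → Carrier) → Carrier
  sumTo n f = sum {n} (f ∘ toℕ)

  sumTo-cong : ∀ n {f g} → (∀ k → k ℕ.< n → f k ≈ g k) → sumTo n f ≈ sumTo n g
  sumTo-cong n h = sum-cong-≋ {n} λ i → h (toℕ i) (toℕ<n i)

  sumTo-last : ∀ n f → sumTo (suc n) f ≈ sumTo n f + f n
  sumTo-last zero    f = trans (+-identityʳ _) (sym (+-identityˡ _))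
  sumTo-last (suc n) f = trans (+-congˡ (sumTo-last n (f ∘ suc))) (sym (+-assoc _ _ _))

  sumTo-+ : ∀ n f g → sumTo n f + sumTo n g ≈ sumTo n (λ k → f k + g k)
  sumTo-+ n f g = sym (∑-distrib-+ {n} (f ∘ toℕ) (g ∘ toℕ))

  *-sumTo : ∀ n x f → x * sumTo n f ≈ sumTo n (λ k → x * f k)
  *-sumTo n x f = *-distribˡ-sum {n} x (f ∘ toℕ)

  ν : ℕ → Carrier
  ν n = n ×ᵣ 1#

  -- Turns the repeated addition of the binomial theorem into a product, which the ring solver can
  -- treat as such.
  ×-ν : ∀ n x → n ×ᵣ x ≈ ν n * x
  ×-ν n x = trans (×-congʳ n (sym (*-identityˡ x))) (sym (×-assoc-* n 1# x))

  binomial : ∀ n x y → (x + y) ^ n ≈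
             sumTo (suc n) (λ k → ν (n C k) * (x ^ k * y ^ (n ℕ.∸ k)))
  binomial n x y = trans (binomialTheorem n x y)
    (sumTo-cong (suc n) λ k _ → ×-ν (n C k) (x ^ k * y ^ (n ℕ.∸ k)))

  -- The Lucas sequence with parameters b and ac

  module Lucas (a b c : Carrier) where

    -- Truncation of `m ∸ 2 j` is harmless: for `2 j > m` the binomial coefficient is 0.
    T : ℕ → ℕ → Carrier
    T m j = (- 1#) ^ j * ν ((m ℕ.∸ j) C j) * a ^ j * b ^ (m ℕ.∸ 2 ℕ.* j) * c ^ j

    T-first : ∀ m → T m 0 ≈ b ^ m
    T-first m = solve 1 (λ x → con 1 :* (con 1 :+ con 0) :* con 1 :* x :* con 1 := x) refl (b ^ m)

    T-zero : ∀ m j → (m ℕ.∸ j) C j ≡ 0 → T m j ≈ 0#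
    T-zero m j e rewrite e = solve 4 (λ x y z w → x :* con 0 :* y :* z :* w := con 0)
      refl _ _ _ _

    -- For 2 j ≥ m the exponents of b are truncated, but then the binomial coefficient is 0.
    *-b-step : ∀ m j → ν ((m ℕ.∸ j) C suc j) * b ^ (m ℕ.∸ 2 ℕ.* j) ≈
               b * (ν ((m ℕ.∸ j) C suc j) * b ^ (suc m ℕ.∸ 2 ℕ.* suc j))
    *-b-step m j with suc j ℕ.≤? m ℕ.∸ j
    ... | no  j≰ rewrite k>n⇒nCk≡0 (ℕ.≰⇒> j≰) =
      trans (zeroˡ _) (sym (trans (*-congˡ (zeroˡ _)) (zeroʳ b)))
    ... | yes j< = begin
      n * b ^ (m ℕ.∸ 2 ℕ.* j)                   ≡⟨ cong (λ i → n * b ^ i) e ⟩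
      n * (b * b ^ (suc m ℕ.∸ 2 ℕ.* suc j))
        ≈⟨ solve 3 (λ n b x → n :* (b :* x) := b :* (n :* x)) refl n b _ ⟩
      b * (n * b ^ (suc m ℕ.∸ 2 ℕ.* suc j))     ∎
      where
      n = ν ((m ℕ.∸ j) C suc j)
      e : m ℕ.∸ 2 ℕ.* j ≡ suc (suc m ℕ.∸ 2 ℕ.* suc j)
      e = ≡.trans (∸-2* m j) (≡.trans (∸-suc j<) (cong suc (≡.sym (∸-2*suc m j))))

    -- Pascal's rule splits C(m+1-j, j+1) into C(m-j, j) and C(m-j, j+1). The first part cancels
    -- against `a * c * T m j`, which has the opposite sign; the second gives the right side.
    T-pascal : ∀ m j → j ℕ.≤ m →
               T (2 ℕ.+ m) (suc j) + a * c * T m j ≈ b * T (suc m) (suc j)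
    T-pascal m j j≤m = begin
      T (2 ℕ.+ m) (suc j) + a * c * T m j
        ≈⟨ +-congʳ (*-congʳ (*-cong (*-congʳ (*-congˡ pascal))
             (^-congʳ b (cong (1 ℕ.+ m ℕ.∸_) (ℕ.+-suc j (j ℕ.+ 0)))))) ⟩
      - 1# * (- 1#) ^ j * (ν₀ + ν₁) * (a * a ^ j) * B * (c * c ^ j) + a * c * T m j
        -- The solver knows only semirings, so -1 enters as an atom `ε` and the cancelling pair is
        -- collected as a multiple of `1 + ε`.
        ≈⟨ solve 9 (λ ε s x y a A B c C →
             ε :* s :* (x :+ y) :* (a :* A) :* B :* (c :* C) :+ a :* c :* (s :* x :* A :* B :* C) :=
             (con 1 :+ ε) :* (s :* x :* (a :* A) :* B :* (c :* C)) :+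
             ε :* s :* (a :* A) :* (c :* C) :* (y :* B))
             refl (- 1#) _ ν₀ ν₁ a _ B c _ ⟩
      (1# + - 1#) * _ + - 1# * (- 1#) ^ j * (a * a ^ j) * (c * c ^ j) * (ν₁ * B)
        ≈⟨ +-cong (trans (*-congʳ (-‿inverseʳ 1#)) (zeroˡ _)) (*-congˡ (*-b-step m j)) ⟩
      0# + - 1# * (- 1#) ^ j * (a * a ^ j) * (c * c ^ j) * (b * (ν₁ * B′))
        ≈⟨ solve 6 (λ s A C b y B → con 0 :+ s :* A :* C :* (b :* (y :* B)) :=
             b :* (s :* y :* A :* B :* C)) refl _ _ _ b ν₁ B′ ⟩
      b * T (suc m) (suc j) ∎
      where
      ν₀ = ν ((m ℕ.∸ j) C j)
      ν₁ = ν ((m ℕ.∸ j) C suc j)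
      B  = b ^ (m ℕ.∸ 2 ℕ.* j)
      B′ = b ^ (suc m ℕ.∸ 2 ℕ.* suc j)
      pascal : ν ((suc m ℕ.∸ j) C suc j) ≈ ν₀ + ν₁
      pascal = begin
        ν ((suc m ℕ.∸ j) C suc j)
          ≡⟨ cong (λ i → ν (i C suc j)) (ℕ.+-∸-assoc 1 j≤m) ⟩
        ν (suc (m ℕ.∸ j) C suc j)
          ≡⟨ cong ν (nCk+nC[k+1]≡[n+1]C[k+1] (m ℕ.∸ j) j) ⟨
        ν ((m ℕ.∸ j) C j ℕ.+ (m ℕ.∸ j) C suc j)
          ≈⟨ ×-homo-+ 1# ((m ℕ.∸ j) C j) _ ⟩
        ν₀ + ν₁ ∎

    -- The Lucas number U_(m+1)(b, ac). The range j ≤ m, longer than the support j ≤ m/2, is that of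
    -- the inner sums in the theorem.
    H : ℕ → Carrier
    H m = sumTo (suc m) (T m)

    -- Sum `T-pascal` over j ≤ m. The terms with index 0 match separately: both are b^(m+2).
    H-rec : ∀ m → H (2 ℕ.+ m) + a * c * H m ≈ b * H (suc m)
    H-rec m = begin
      H (2 ℕ.+ m) + a * c * H m
        ≈⟨ +-cong (+-cong (T-first (2 ℕ.+ m)) tail) (*-sumTo (suc m) (a * c) (T m)) ⟩
      b ^ (2 ℕ.+ m) + sumTo (suc m) (T (2 ℕ.+ m) ∘ suc) + sumTo (suc m) (λ j → a * c * T m j)
        ≈⟨ trans (+-assoc _ _ _) (+-congˡ
             (sumTo-+ (suc m) (T (2 ℕ.+ m) ∘ suc) (λ j → a * c * T m j))) ⟩
      b ^ (2 ℕ.+ m) + sumTo (suc m) (λ j → T (2 ℕ.+ m) (suc j) + a * c * T m j)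
        ≈⟨ +-congˡ (sumTo-cong (suc m) λ j j≤m → T-pascal m j (ℕ.≤-pred j≤m)) ⟩
      b ^ (2 ℕ.+ m) + sumTo (suc m) (λ j → b * T (suc m) (suc j))
        ≈⟨ +-cong (*-congˡ (T-first (suc m))) (*-sumTo (suc m) b (T (suc m) ∘ suc)) ⟨
      b * T (suc m) 0 + b * sumTo (suc m) (T (suc m) ∘ suc)
        ≈⟨ distribˡ _ _ _ ⟨
      b * H (suc m) ∎
      where
      -- `H (2 + m)` has one term more than `H (suc m)`; it carries the coefficient C(0, m+2) = 0.
      tail : sumTo (2 ℕ.+ m) (T (2 ℕ.+ m) ∘ suc) ≈ sumTo (suc m) (T (2 ℕ.+ m) ∘ suc)
      tail = trans (sumTo-last (suc m) (T (2 ℕ.+ m) ∘ suc)) (trans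
        (+-congˡ (T-zero (2 ℕ.+ m) (2 ℕ.+ m) (cong (_C (2 ℕ.+ m)) (ℕ.n∸n≡0 m)))) (+-identityʳ _))

  -- Vieta's relations and differences of powers

  module Roots
    -- `D` stands for v - w, given through a sum; the root equations are free of subtraction too, so
    -- that the semiring solver applies throughout.
    (a b c v w D : Carrier) (D+w≈v : D + w ≈ v)
    (root-v : a * (v * v) + c ≈ b * v) (root-w : a * (w * w) + c ≈ b * w)
    (d : Carrier) (Dd≈1 : D * d ≈ 1#)
    where

    open Lucas a b c

    -- The difference of the two root equations is a (v + w) D = b D, and `D` has the inverse `d`.
    vieta-sum : a * (v + w) ≈ b
    vieta-sum = begin
      a * (v + w)             ≈⟨ *-identityʳ _ ⟨
      a * (v + w) * 1#        ≈⟨ *-congˡ Dd≈1 ⟨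
      a * (v + w) * (D * d)   ≈⟨ solve 4 (λ a s D d → a :* s :* (D :* d) := a :* s :* D :* d) refl _ _ _ _ ⟩
      a * (v + w) * D * d     ≈⟨ *-congʳ eq ⟩
      b * D * d               ≈⟨ *-assoc _ _ _ ⟩
      b * (D * d)             ≈⟨ *-congˡ Dd≈1 ⟩
      b * 1#                  ≈⟨ *-identityʳ _ ⟩
      b                       ∎
      where
      eq : a * (v + w) * D ≈ b * D
      eq = +-cancelʳ (b * w) _ _ (begin
        a * (v + w) * D + b * w                    ≈⟨ +-congˡ root-w ⟨
        a * (v + w) * D + (a * (w * w) + c)        ≈⟨ +-congʳ (*-congʳ (*-congˡ (+-congʳ D+w≈v))) ⟨
        a * (D + w + w) * D + (a * (w * w) + c)
          ≈⟨ solve 4 (λ a c w D → a :* (D :+ w :+ w) :* D :+ (a :* (w :* w) :+ c) :=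
                                  a :* ((D :+ w) :* (D :+ w)) :+ c) refl a c w D ⟩
        a * ((D + w) * (D + w)) + c                ≈⟨ +-congʳ (*-congˡ (*-cong D+w≈v D+w≈v)) ⟩
        a * (v * v) + c                            ≈⟨ root-v ⟩
        b * v                                      ≈⟨ *-congˡ D+w≈v ⟨
        b * (D + w)                                ≈⟨ distribˡ _ _ _ ⟩
        b * D + b * w                              ∎)

    -- By `vieta-sum`, a v² + a v w = b v, and the root equation for v says that b v = a v² + c.
    vieta-product : a * (v * w) ≈ c
    vieta-product = +-cancelˡ (a * (v * v)) _ _ (begin
      a * (v * v) + a * (v * w)
        ≈⟨ solve 3 (λ a v w → a :* (v :* v) :+ a :* (v :* w) := a :* (v :+ w) :* v) refl a v w ⟩
      a * (v + w) * v           ≈⟨ *-congʳ vieta-sum ⟩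
      b * v                     ≈⟨ root-v ⟨
      a * (v * v) + c           ∎)

    -- The root equation multiplied by a^(m+1) u^(m+1): the sequence a^m u^(m+1) obeys the
    -- recurrence of `H`.
    power-rec : ∀ {u} → a * (u * u) + c ≈ b * u → ∀ m →
      a ^ (2 ℕ.+ m) * u ^ (3 ℕ.+ m) + a * c * (a ^ m * u ^ suc m) ≈
      b * (a ^ suc m * u ^ (2 ℕ.+ m))
    power-rec {u} root m = begin
      a ^ (2 ℕ.+ m) * u ^ (3 ℕ.+ m) + a * c * (a ^ m * u ^ suc m)
        ≈⟨ solve 5 (λ a c u A U →
             a :* (a :* A) :* (u :* (u :* (u :* U))) :+ a :* c :* (A :* (u :* U)) :=
             (a :* (u :* u) :+ c) :* (a :* A :* (u :* U))) refl a c u (a ^ m) (u ^ m) ⟩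
      (a * (u * u) + c) * (a ^ suc m * u ^ suc m)
        ≈⟨ *-congʳ root ⟩
      b * u * (a ^ suc m * u ^ suc m)
        ≈⟨ solve 4 (λ b u A U → b :* u :* (A :* U) := b :* (A :* (u :* U))) refl b u _ _ ⟩
      b * (a ^ suc m * u ^ (2 ℕ.+ m)) ∎

    -- Induction over two steps, as both sides obey one recurrence. The initial values are H₀ = 1,
    -- by `D+w≈v`, and H₁ = b, by `vieta-sum`.
    power-difference : ∀ m → a ^ m * v ^ suc m ≈ D * H m + a ^ m * w ^ suc m
    power-difference zero = begin
      1# * (v * 1#)            ≈⟨ solve 1 (λ v → con 1 :* (v :* con 1) := v) refl v ⟩
      v                        ≈⟨ D+w≈v ⟨
      D + w                    ≈⟨ solve 2 (λ D w → D :+ w := D :* con 1 :+ con 1 :* (w :* con 1)) refl D w ⟩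
      D * 1# + 1# * (w * 1#)   ≈⟨ +-congʳ (*-congˡ (trans (+-congʳ (T-first 0)) (+-identityʳ _))) ⟨
      D * H 0 + 1# * (w * 1#)  ∎
    power-difference (suc zero) = begin
      a * 1# * (v * (v * 1#))
        ≈⟨ solve 2 (λ a v → a :* con 1 :* (v :* (v :* con 1)) := a :* (v :* v)) refl a v ⟩
      a * (v * v)                  ≈⟨ *-congˡ (*-congʳ D+w≈v) ⟨
      a * ((D + w) * v)
        ≈⟨ solve 4 (λ a v w D → a :* ((D :+ w) :* v) := D :* (a :* v) :+ a :* w :* v) refl a v w D ⟩
      D * (a * v) + a * w * v      ≈⟨ +-congˡ (*-congˡ D+w≈v) ⟨
      D * (a * v) + a * w * (D + w)
        ≈⟨ solve 4 (λ a v w D → D :* (a :* v) :+ a :* w :* (D :+ w) :=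
             D :* (a :* (v :+ w)) :+ a :* con 1 :* (w :* (w :* con 1))) refl a v w D ⟩
      D * (a * (v + w)) + a * 1# * (w * (w * 1#))  ≈⟨ +-congʳ (*-congˡ vieta-sum) ⟩
      D * b + a * 1# * (w * (w * 1#))              ≈⟨ +-congʳ (*-congˡ H₁) ⟨
      D * H 1 + a * 1# * (w * (w * 1#))            ∎
      where
      H₁ : H 1 ≈ b
      H₁ = begin
        T 1 0 + (T 1 1 + 0#)  ≈⟨ +-cong (T-first 1) (+-congʳ (T-zero 1 1 ≡.refl)) ⟩
        b * 1# + (0# + 0#)    ≈⟨ solve 1 (λ b → b :* con 1 :+ (con 0 :+ con 0) := b) refl b ⟩
        b                     ∎
    -- Instead of subtracting in the recurrence, the lower term is added to both sides; on the right
    -- it is absorbed through the induction hypothesis for `m`.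
    power-difference (suc (suc m)) = +-cancelʳ (a * c * (a ^ m * v ^ suc m)) _ _ (begin
      a ^ (2 ℕ.+ m) * v ^ (3 ℕ.+ m) + a * c * (a ^ m * v ^ suc m)
        ≈⟨ power-rec root-v m ⟩
      b * (a ^ suc m * v ^ (2 ℕ.+ m))
        ≈⟨ *-congˡ (power-difference (suc m)) ⟩
      b * (D * H (suc m) + a ^ suc m * w ^ (2 ℕ.+ m))
        ≈⟨ solve 4 (λ b D h y → b :* (D :* h :+ y) := D :* (b :* h) :+ b :* y) refl b D _ _ ⟩
      D * (b * H (suc m)) + b * (a ^ suc m * w ^ (2 ℕ.+ m))
        ≈⟨ +-cong (*-congˡ (H-rec m)) (power-rec root-w m) ⟨
      D * (H (2 ℕ.+ m) + a * c * H m) + (a ^ (2 ℕ.+ m) * w ^ (3 ℕ.+ m) + a * c * (a ^ m * w ^ suc m))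
        ≈⟨ solve 6 (λ D h f k y z → D :* (h :+ f :* k) :+ (y :+ f :* z) :=
             D :* h :+ y :+ f :* (D :* k :+ z)) refl D _ _ _ _ _ ⟩
      D * H (2 ℕ.+ m) + a ^ (2 ℕ.+ m) * w ^ (3 ℕ.+ m) + a * c * (D * H m + a ^ m * w ^ suc m)
        ≈⟨ +-congˡ (*-congˡ (power-difference m)) ⟨
      D * H (2 ℕ.+ m) + a ^ (2 ℕ.+ m) * w ^ (3 ℕ.+ m) + a * c * (a ^ m * v ^ suc m) ∎)

    -- Splitting a^M as a^k a^m leaves a^m v^(m+1) for `power-difference`. The exponents come with
    -- equations so that truncated differences can be supplied for them.
    Q-term : ∀ {M e} k m n y → M ≡ k ℕ.+ m → e ≡ suc m →
      a ^ M * (n * (y * v ^ e)) ≈ D * (n * (a ^ k * y) * H m) + a ^ M * (n * (y * w ^ e))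
    Q-term k m n y ≡.refl ≡.refl = begin
      a ^ (k ℕ.+ m) * (n * (y * v ^ suc m))
        ≈⟨ *-congʳ (^-homo-* a k m) ⟩
      a ^ k * a ^ m * (n * (y * v ^ suc m))
        ≈⟨ solve 5 (λ A B n y V → A :* B :* (n :* (y :* V)) := n :* (A :* y) :* (B :* V))
             refl _ _ n y _ ⟩
      n * (a ^ k * y) * (a ^ m * v ^ suc m)
        ≈⟨ *-congˡ (power-difference m) ⟩
      n * (a ^ k * y) * (D * H m + a ^ m * w ^ suc m)
        ≈⟨ solve 7 (λ A B n y W D h → n :* (A :* y) :* (D :* h :+ B :* W) :=
             D :* (n :* (A :* y) :* h) :+ A :* B :* (n :* (y :* W))) refl _ _ n y _ D (H m) ⟩
      D * (n * (a ^ k * y) * H m) + a ^ k * a ^ m * (n * (y * w ^ suc m))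
        ≈⟨ +-congˡ (*-congʳ (^-homo-* a k m)) ⟨
      D * (n * (a ^ k * y) * H m) + a ^ (k ℕ.+ m) * (n * (y * w ^ suc m)) ∎

    -- Both products contain the factor a v w, which is c by `vieta-product`; what remains is
    -- `power-difference` for `m`.
    P-term : ∀ {M e} k m n y → M ≡ k ℕ.+ suc m → e ≡ 2 ℕ.+ m →
      a ^ M * (v * (n * (y * w ^ e))) + D * (n * (a ^ k * y) * (c * H m)) ≈
      a ^ M * (w * (n * (y * v ^ e)))
    P-term k m n y ≡.refl ≡.refl = begin
      a ^ (k ℕ.+ suc m) * (v * (n * (y * w ^ (2 ℕ.+ m)))) + D * (n * (a ^ k * y) * (c * H m))
        ≈⟨ +-cong (*-congʳ (^-homo-* a k (suc m))) (*-congˡ (*-congˡ (*-congʳ (sym vieta-product)))) ⟩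
      a ^ k * a ^ suc m * (v * (n * (y * w ^ (2 ℕ.+ m)))) + D * (n * (a ^ k * y) * (a * (v * w) * H m))
        ≈⟨ solve 10 (λ A B n y W D h a v w →
             A :* (a :* B) :* (v :* (n :* (y :* (w :* W)))) :+ D :* (n :* (A :* y) :* (a :* (v :* w) :* h)) :=
             n :* (A :* y) :* (a :* (v :* w)) :* (D :* h :+ B :* W))
             refl (a ^ k) (a ^ m) n y (w ^ suc m) D (H m) a v w ⟩
      n * (a ^ k * y) * (a * (v * w)) * (D * H m + a ^ m * w ^ suc m)
        ≈⟨ *-congˡ (power-difference m) ⟨
      n * (a ^ k * y) * (a * (v * w)) * (a ^ m * v ^ suc m)
        ≈⟨ solve 8 (λ A B n y V a v w →
             n :* (A :* y) :* (a :* (v :* w)) :* (B :* V) :=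
             A :* (a :* B) :* (w :* (n :* (y :* (v :* V)))))
             refl (a ^ k) (a ^ m) n y (v ^ suc m) a v w ⟩
      a ^ k * a ^ suc m * (w * (n * (y * v ^ (2 ℕ.+ m))))
        ≈⟨ *-congʳ (^-homo-* a k (suc m)) ⟨
      a ^ (k ℕ.+ suc m) * (w * (n * (y * v ^ (2 ℕ.+ m)))) ∎

    -- Summation of the binomial expansions

    module _ (x : Carrier) (M : ℕ) where

      private N = suc M

      term : Carrier → ℕ → Carrier
      term u k = ν (N C k) * (x ^ k * u ^ (N ℕ.∸ k))

      term-N : ∀ u → term u N ≈ x ^ N
      term-N u = begin
        ν (N C N) * (x ^ N * u ^ (N ℕ.∸ N))
          ≡⟨ ≡.cong₂ (λ i j → ν i * (x ^ N * u ^ j)) (nCn≡1 N) (ℕ.n∸n≡0 N) ⟩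
        (1# + 0#) * (x ^ N * 1#)
          ≈⟨ solve 1 (λ y → (con 1 :+ con 0) :* (y :* con 1) := y) refl (x ^ N) ⟩
        x ^ N ∎

      -- The term with k = N is split off: its power of `u` is the zeroth, out of reach of `Q-term`
      -- and `P-term`.
      *-binomial : ∀ y u → y * (x + u) ^ N ≈ sumTo N (λ k → y * term u k) + y * x ^ N
      *-binomial y u = begin
        y * (x + u) ^ N                               ≈⟨ *-congˡ (binomial N x u) ⟩
        y * sumTo (suc N) (term u)                    ≈⟨ *-congˡ (sumTo-last N (term u)) ⟩
        y * (sumTo N (term u) + term u N)             ≈⟨ distribˡ _ _ _ ⟩
        y * sumTo N (term u) + y * term u N
          ≈⟨ +-cong (*-sumTo N y (term u)) (*-congˡ (term-N u)) ⟩
        sumTo N (λ k → y * term u k) + y * x ^ N      ∎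

      coefficient : ℕ → Carrier
      coefficient k = ν (N C k) * (a ^ k * x ^ k)

      Q-sum P-sum : Carrier
      Q-sum = sumTo N λ k → coefficient k * H (N ℕ.∸ k ℕ.∸ 1)
      P-sum = sumTo M λ k → coefficient k * (c * H (N ℕ.∸ k ℕ.∸ 2))

      M≡k+ : ∀ {k} → k ℕ.< N → M ≡ k ℕ.+ (N ℕ.∸ k ℕ.∸ 1)
      M≡k+ {k} k<N = ≡.sym (≡.trans (cong (k ℕ.+_) (∸-swap N k 1)) (ℕ.m+[n∸m]≡n (ℕ.≤-pred k<N)))

      -- `Q-term` for each k < N; the leading terms for v and w are equal.
      Q-identity : a ^ M * (x + v) ^ N ≈ D * Q-sum + a ^ M * (x + w) ^ N
      Q-identity = begin
        a ^ M * (x + v) ^ N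
          ≈⟨ *-binomial (a ^ M) v ⟩
        sumTo N (λ k → a ^ M * term v k) + a ^ M * x ^ N
          ≈⟨ +-congʳ (sumTo-cong N λ k k<N →
               Q-term k _ (ν (N C k)) (x ^ k) (M≡k+ k<N) (∸-suc k<N)) ⟩
        sumTo N (λ k → D * f k + a ^ M * term w k) + a ^ M * x ^ N
          ≈⟨ +-congʳ (sumTo-+ N (λ k → D * f k) (λ k → a ^ M * term w k)) ⟨
        sumTo N (λ k → D * f k) + sumTo N (λ k → a ^ M * term w k) + a ^ M * x ^ N
          ≈⟨ trans (+-assoc _ _ _) (+-cong (sym (*-sumTo N D f)) (sym (*-binomial (a ^ M) w))) ⟩
        D * Q-sum + a ^ M * (x + w) ^ N ∎
        where
        f : ℕ → Carrier
        f k = coefficient k * H (N ℕ.∸ k ℕ.∸ 1)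

      -- `P-term` handles k < M. At k = N the factors v and w differ by `D`, which produces the
      -- leading term of `P`.
      P-identity : a ^ M * (v * (x + w) ^ N) + D * P-sum ≈
                   D * (a ^ M * x ^ N) + a ^ M * (w * (x + v) ^ N)
      P-identity = begin
        a ^ M * (v * (x + w) ^ N) + D * P-sum
          ≈⟨ +-cong (expand v w) (*-sumTo M D f) ⟩
        sumTo M (g v w) + g v w M + a ^ M * v * x ^ N + sumTo M (λ k → D * f k)
          ≈⟨ solve 4 (λ p q r s → p :+ q :+ r :+ s := (p :+ s) :+ q :+ r) refl _ _ _ _ ⟩
        sumTo M (g v w) + sumTo M (λ k → D * f k) + g v w M + a ^ M * v * x ^ N
          ≈⟨ +-cong (+-cong (sumTo-+ M (g v w) (λ k → D * f k)) middle) (*-congʳ (*-congˡ (sym D+w≈v))) ⟩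
        sumTo M (λ k → g v w k + D * f k) + g w v M + a ^ M * (D + w) * x ^ N
          ≈⟨ +-congʳ (+-congʳ (sumTo-cong M λ k k<M →
               let k<N = ℕ.m<n⇒m<1+n k<M
                   e   = ∸1≡suc-∸2 k<M
               in trans (+-congʳ (*-assoc _ _ _)) (trans
                    (P-term k _ (ν (N C k)) (x ^ k)
                      (≡.trans (M≡k+ k<N) (cong (k ℕ.+_) e))
                      (≡.trans (∸-suc k<N) (cong suc e)))
                    (sym (*-assoc _ _ _))))) ⟩
        sumTo M (g w v) + g w v M + a ^ M * (D + w) * x ^ N
          ≈⟨ solve 5 (λ p A D w y → p :+ A :* (D :+ w) :* y :=
               D :* (A :* y) :+ (p :+ A :* w :* y)) refl _ (a ^ M) D w (x ^ N) ⟩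
        D * (a ^ M * x ^ N) + (sumTo M (g w v) + g w v M + a ^ M * w * x ^ N)
          ≈⟨ +-congˡ (expand w v) ⟨
        D * (a ^ M * x ^ N) + a ^ M * (w * (x + v) ^ N) ∎
        where
        f : ℕ → Carrier
        f k = coefficient k * (c * H (N ℕ.∸ k ℕ.∸ 2))
        g : Carrier → Carrier → ℕ → Carrier
        g y u k = a ^ M * y * term u k
        expand : ∀ y u → a ^ M * (y * (x + u) ^ N) ≈ sumTo M (g y u) + g y u M + a ^ M * y * x ^ N
        expand y u = trans (sym (*-assoc _ _ _))
          (trans (*-binomial (a ^ M * y) u) (+-congʳ (sumTo-last M (g y u))))
        -- At k = N - 1 the power is the first, so both terms contain v and w symmetrically.
        middle : g v w M ≈ g w v M
        middle = begin
          g v w M                                        ≡⟨ g-M v w ⟩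
          a ^ M * v * (ν (N C M) * (x ^ M * (w * 1#)))
            ≈⟨ solve 5 (λ A v w n y →
                 A :* v :* (n :* (y :* (w :* con 1))) := A :* w :* (n :* (y :* (v :* con 1))))
                 refl (a ^ M) v w (ν (N C M)) (x ^ M) ⟩
          a ^ M * w * (ν (N C M) * (x ^ M * (v * 1#)))   ≡⟨ g-M w v ⟨
          g w v M                                        ∎
          where
          g-M : ∀ y u → g y u M ≡ a ^ M * y * (ν (N C M) * (x ^ M * (u * 1#)))
          g-M y u = cong (λ i → a ^ M * y * (ν (N C M) * (x ^ M * u ^ i))) (ℕ.m+n∸n≡m 1 M)

  -- Multiplication by `d` brings back the quotient and the subtraction avoided so far; `A * d`
  -- becomes the factor a^(N-1)/(r₁ - r₂).
  divide : ∀ {A D d p q s} → D * d ≈ 1# → A * p ≈ D * s + A * q → A * d * (p - q) ≈ s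
  divide {A} {D} {d} {p} {q} {s} Dd≈1 e = +-cancelʳ (A * d * q) _ _ (begin
    A * d * (p - q) + A * d * q    ≈⟨ distribˡ _ _ _ ⟨
    A * d * (p - q + q)
      ≈⟨ *-congˡ (trans (+-assoc _ _ _) (trans (+-congˡ (-‿inverseˡ q)) (+-identityʳ p))) ⟩
    A * d * p                      ≈⟨ solve 3 (λ A d p → A :* d :* p := A :* p :* d) refl A d p ⟩
    A * p * d                      ≈⟨ *-congʳ e ⟩
    (D * s + A * q) * d
      ≈⟨ solve 5 (λ D s A q d → (D :* s :+ A :* q) :* d := D :* d :* s :+ A :* d :* q) refl D s A q d ⟩
    D * d * s + A * d * q          ≈⟨ +-congʳ (trans (*-congʳ Dd≈1) (*-identityˡ s)) ⟩
    s + A * d * q                  ∎)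

  -- Expansions in terms of the roots r₁ and r₂

  module _ (a b c r₁ r₂ d : Carrier)
    (root₁ : a * r₁ ^ 2 + b * r₁ + c ≈ 0#) (root₂ : a * r₂ ^ 2 + b * r₂ + c ≈ 0#)
    (inverse : (r₁ - r₂) * d ≈ 1#) where

    private
      -- Passing to -r moves the linear term to the other side, which gives the form that `Roots`
      -- asks for.
      neg-root : ∀ {r} → a * r ^ 2 + b * r + c ≈ 0# → a * (- r * - r) + c ≈ b * - r
      neg-root {r} root = +-cancelʳ (b * r) _ _ (begin
        a * (- r * - r) + c + b * r   ≈⟨ +-congʳ (+-congʳ (*-congˡ -r*-r≈r*r)) ⟩
        a * (r * r) + c + b * r
          ≈⟨ solve 4 (λ a b c r → a :* (r :* r) :+ c :+ b :* r :=
               a :* (r :* (r :* con 1)) :+ b :* r :+ c) refl a b c r ⟩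
        a * r ^ 2 + b * r + c         ≈⟨ root ⟩
        0#                            ≈⟨ zeroʳ b ⟨
        b * 0#                        ≈⟨ *-congˡ (-‿inverseˡ r) ⟨
        b * (- r + r)                 ≈⟨ distribˡ _ _ _ ⟩
        b * - r + b * r               ∎)
        where
        -r*-r≈r*r : - r * - r ≈ r * r
        -r*-r≈r*r = trans (sym (-‿distribˡ-* r (- r)))
          (trans (-‿cong (sym (-‿distribʳ-* r r))) (-‿involutive (r * r)))

      D+w≈v : r₁ - r₂ + - r₁ ≈ - r₂
      D+w≈v = trans (+-congʳ (+-comm r₁ (- r₂))) (trans (+-assoc _ _ _)
        (trans (+-congˡ (-‿inverseʳ r₁)) (+-identityʳ _)))

    open Roots a b c (- r₂) (- r₁) (r₁ - r₂) D+w≈v (neg-root root₂) (neg-root root₁) d inverse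

    Q-expansion : ∀ x M → a ^ M * d * ((x - r₂) ^ suc M - (x - r₁) ^ suc M) ≈ Q-sum x M
    Q-expansion x M = divide inverse (Q-identity x M)

    P-expansion : ∀ x M →
      a ^ M * d * (r₁ * (x - r₂) ^ suc M - r₂ * (x - r₁) ^ suc M) ≈
      a ^ M * x ^ suc M - P-sum x M
    -- The summand added to both sides cancels r₁ p on the left and leaves there the left side of
    -- `P-identity`; on the right it restores r₂ q and the subtraction of `S`.
    P-expansion x M = divide inverse (+-cancelʳ (A * (- r₁ * p) + (A * (- r₂ * q) + D * S)) _ _ (begin
      A * (r₁ * p) + (A * (- r₁ * p) + (A * (- r₂ * q) + D * S))
        ≈⟨ solve 7 (λ A r s p z D S → A :* (r :* p) :+ (A :* (s :* p) :+ (z :+ D :* S)) :=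
             A :* ((r :+ s) :* p) :+ (z :+ D :* S)) refl A r₁ (- r₁) p _ D S ⟩
      A * ((r₁ - r₁) * p) + (A * (- r₂ * q) + D * S)
        ≈⟨ +-cong (vanish r₁ p) (P-identity x M) ⟩
      0# + (D * y + A * (- r₁ * p))
        ≈⟨ +-cong (vanish r₂ q) (+-congʳ (*-congˡ
             (trans (+-assoc _ _ _) (trans (+-congˡ (-‿inverseˡ S)) (+-identityʳ y))))) ⟨
      A * ((r₂ - r₂) * q) + (D * (y - S + S) + A * (- r₁ * p))
        ≈⟨ solve 8 (λ A r s q D t S z →
             A :* ((r :+ s) :* q) :+ (D :* (t :+ S) :+ z) :=
             D :* t :+ A :* (r :* q) :+ (z :+ (A :* (s :* q) :+ D :* S)))
             refl A r₂ (- r₂) q D (y - S) S _ ⟩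
      D * (y - S) + A * (r₂ * q) + (A * (- r₁ * p) + (A * (- r₂ * q) + D * S)) ∎))
      where
      A = a ^ M
      D = r₁ - r₂
      S = P-sum x M
      y = a ^ M * x ^ suc M
      p = (x - r₂) ^ suc M
      q = (x - r₁) ^ suc M
      vanish : ∀ r z → A * ((r - r) * z) ≈ 0#
      vanish r z = trans (*-congˡ (trans (*-congʳ (-‿inverseʳ r)) (zeroˡ z))) (zeroʳ A)

-- Coefficients in one ring, the variable in another

module Homomorphic
  {c₁ ℓ₁ c₂ ℓ₂} (R : CommutativeRing c₁ ℓ₁) (S : CommutativeRing c₂ ℓ₂)
  {φ : CommutativeRing.Carrier R → CommutativeRing.Carrier S}
  (φ-homo : IsRingHomomorphism (CommutativeRing.rawRing R) (CommutativeRing.rawRing S) φ)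
  where

  private
    module R = CommutativeRing R
  open CommutativeRing S
  open IsRingHomomorphism φ-homo using (⟦⟧-cong; +-homo; *-homo; 0#-homo; 1#-homo; -‿homo)
  open import Algebra.Properties.Semiring.Exp R.semiring using () renaming (_^_ to _^ᴿ_)
  open import Algebra.Properties.Semiring.Mult R.semiring using () renaming (_×_ to _×ᴿ_)
  open import Algebra.Properties.Semiring.Exp semiring using (_^_; ^-homo-*; ^-congˡ)
  open import Algebra.Solver.Ring.NaturalCoefficients.Default commutativeSemiring
    using (solve; _:=_; _:*_)
  open import Relation.Binary.Reasoning.Setoid setoid
  open Expansion S

  νᴿ : ℕ → R.Carrier
  νᴿ n = n ×ᴿ R.1#

  ^-homo : ∀ x n → φ (x ^ᴿ n) ≈ φ x ^ n
  ^-homo x zero    = 1#-homo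
  ^-homo x (suc n) = trans (*-homo x _) (*-congˡ (^-homo x n))

  ν-homo : ∀ n → φ (νᴿ n) ≈ ν n
  ν-homo zero    = 0#-homo
  ν-homo (suc n) = trans (+-homo R.1# _) (+-cong 1#-homo (ν-homo n))

  minus-homo : ∀ x y → φ (x R.- y) ≈ φ x - φ y
  minus-homo x y = trans (+-homo x _) (+-congˡ (-‿homo y))

  module _ (a b c r₁ r₂ d : R.Carrier)
    (root₁ : a R.* r₁ ^ᴿ 2 R.+ b R.* r₁ R.+ c R.≈ R.0#)
    (root₂ : a R.* r₂ ^ᴿ 2 R.+ b R.* r₂ R.+ c R.≈ R.0#)
    (inverse : (r₁ R.- r₂) R.* d R.≈ R.1#) (x : Carrier) where

    open Lucas (φ a) (φ b) (φ c)

    root-homo : ∀ {r} → a R.* r ^ᴿ 2 R.+ b R.* r R.+ c R.≈ R.0# →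
                φ a * φ r ^ 2 + φ b * φ r + φ c ≈ 0#
    root-homo {r} root = begin
      φ a * φ r ^ 2 + φ b * φ r + φ c
        ≈⟨ +-congʳ (+-cong (trans (*-homo a _) (*-congˡ (^-homo r 2))) (*-homo b r)) ⟨
      φ (a R.* r ^ᴿ 2) + φ (b R.* r) + φ c
        ≈⟨ trans (+-homo _ c) (+-congʳ (+-homo _ _)) ⟨
      φ (a R.* r ^ᴿ 2 R.+ b R.* r R.+ c)   ≈⟨ ⟦⟧-cong root ⟩
      φ R.0#                               ≈⟨ 0#-homo ⟩
      0#                                   ∎

    inverse-homo : (φ r₁ - φ r₂) * φ d ≈ 1#
    inverse-homo = trans (*-congʳ (sym (minus-homo r₁ r₂)))
      (trans (sym (*-homo _ d)) (trans (⟦⟧-cong inverse) 1#-homo))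

    -- Common form of the coefficients: `p` is C(N, k), `n` is N - k, the offset `o` is 1 for `Q`
    -- and 2 for `P`, and `z` is the power of c.
    summand : (p k n o j : ℕ) → R.Carrier → R.Carrier
    summand p k n o j z = (R.- R.1#) ^ᴿ j R.* νᴿ p R.* νᴿ ((n ℕ.∸ j ℕ.∸ o) C j)
      R.* a ^ᴿ (k ℕ.+ j) R.* b ^ᴿ (n ℕ.∸ 2 ℕ.* j ℕ.∸ o) R.* z

    -- `y` is the surplus over c^j: 1 for `Q` and c for `P`. Moving the offset `o` to the front
    -- turns the rest into `T (n ∸ o) j`.
    summand-homo : ∀ p k n o j {z y} → φ z ≈ y * φ c ^ j →
      φ (summand p k n o j z) * x ^ k ≈ ν p * (φ a ^ k * x ^ k) * (y * T (n ℕ.∸ o) j)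
    summand-homo p k n o j {z} {y} z≈ = begin
      φ (summand p k n o j z) * x ^ k
        ≈⟨ *-congʳ (trans (*-homo _ _) (*-cong (trans (*-homo _ _) (*-cong (trans (*-homo _ _)
             (*-cong (trans (*-homo _ _) (*-cong (trans (*-homo _ _)
               (*-cong sign (ν-homo p))) (ν-homo (q (n ℕ.∸ j ℕ.∸ o)))))
               (trans (^-homo a (k ℕ.+ j)) (^-homo-* (φ a) k j)))) (^-homo b e))) z≈)) ⟩
      (- 1#) ^ j * ν p * ν (q (n ℕ.∸ j ℕ.∸ o)) * (φ a ^ k * φ a ^ j) * φ b ^ e * (y * φ c ^ j) * x ^ k
        ≡⟨ ≡.cong₂ (λ q′ e′ → (- 1#) ^ j * ν p * ν (q q′) * (φ a ^ k * φ a ^ j) * φ b ^ e′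
                              * (y * φ c ^ j) * x ^ k)
             (∸-swap n j o) (∸-swap n (2 ℕ.* j) o) ⟩
      (- 1#) ^ j * ν p * ν (q (m ℕ.∸ j)) * (φ a ^ k * φ a ^ j) * φ b ^ (m ℕ.∸ 2 ℕ.* j)
        * (y * φ c ^ j) * x ^ k
        ≈⟨ solve 9 (λ s p q A B b y c x → s :* p :* q :* (A :* B) :* b :* (y :* c) :* x :=
             p :* (A :* x) :* (y :* (s :* q :* B :* b :* c)))
             refl _ (ν p) (ν (q (m ℕ.∸ j))) (φ a ^ k) _ _ y _ (x ^ k) ⟩
      ν p * (φ a ^ k * x ^ k) * (y * T m j) ∎
      where
      m = n ℕ.∸ o
      q = _C j
      e = n ℕ.∸ 2 ℕ.* j ℕ.∸ o
      sign : φ ((R.- R.1#) ^ᴿ j) ≈ (- 1#) ^ j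
      sign = trans (^-homo _ j) (^-congˡ j (trans (-‿homo R.1#) (-‿cong 1#-homo)))

    -- With n = N - k and offset `o`, the inner range of the theorem is exactly that of `H (n ∸ o)`.
    inner-sum : ∀ p k n o {l} {z : ℕ → R.Carrier} {y} → l ≡ suc (n ℕ.∸ o) →
      (∀ j → φ (z j) ≈ y * φ c ^ j) →
      sumTo l (λ j → φ (summand p k n o j (z j)) * x ^ k) ≈
      ν p * (φ a ^ k * x ^ k) * (y * H (n ℕ.∸ o))
    inner-sum p k n o {z = z} {y} ≡.refl z≈ = begin
      sumTo (suc m) (λ j → φ (summand p k n o j (z j)) * x ^ k)
        ≈⟨ sumTo-cong (suc m) (λ j _ → summand-homo p k n o j (z≈ j)) ⟩
      sumTo (suc m) (λ j → u * (y * T m j))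
        ≈⟨ *-sumTo (suc m) u (λ j → y * T m j) ⟨
      u * sumTo (suc m) (λ j → y * T m j)
        ≈⟨ *-congˡ (*-sumTo (suc m) y (T m)) ⟨
      u * (y * H m) ∎
      where
      m = n ℕ.∸ o
      u = ν p * (φ a ^ k * x ^ k)

    scalar-homo : ∀ M → φ (a ^ᴿ M R.* d) ≈ φ a ^ M * φ d
    scalar-homo M = trans (*-homo _ d) (*-congʳ (^-homo a M))

    Q-homo : ∀ N .{{_ : ℕ.NonZero N}} →
      φ (a ^ᴿ (N ℕ.∸ 1) R.* d) * ((x - φ r₂) ^ N - (x - φ r₁) ^ N) ≈
      sumTo N λ k → sumTo (N ℕ.∸ k) λ j →
        φ ((R.- R.1#) ^ᴿ j R.* νᴿ (N C k) R.* νᴿ ((N ℕ.∸ k ℕ.∸ j ℕ.∸ 1) C j)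
           R.* a ^ᴿ (k ℕ.+ j) R.* b ^ᴿ (N ℕ.∸ k ℕ.∸ 2 ℕ.* j ℕ.∸ 1) R.* c ^ᴿ j)
        * x ^ k
    -- Matching on `suc M` makes `N ∸ 1` compute to `M`.
    Q-homo N@(suc M) = trans (*-congʳ (scalar-homo M)) (trans
      (Q-expansion (φ a) (φ b) (φ c) (φ r₁) (φ r₂) (φ d)
        (root-homo root₁) (root-homo root₂) inverse-homo x M)
      (sumTo-cong N λ k k<N → sym (trans
        (inner-sum (N C k) k (N ℕ.∸ k) 1 (∸-suc k<N) λ j →
          trans (^-homo c j) (sym (*-identityˡ _)))
        (*-congˡ (*-identityˡ _)))))

    P-homo : ∀ N .{{_ : ℕ.NonZero N}} →
      φ (a ^ᴿ (N ℕ.∸ 1) R.* d) * (φ r₁ * (x - φ r₂) ^ N - φ r₂ * (x - φ r₁) ^ N) ≈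
      φ (a ^ᴿ (N ℕ.∸ 1)) * x ^ N -
      (sumTo (N ℕ.∸ 1) λ k → sumTo (N ℕ.∸ k ℕ.∸ 1) λ j →
        φ ((R.- R.1#) ^ᴿ j R.* νᴿ (N C k) R.* νᴿ ((N ℕ.∸ k ℕ.∸ j ℕ.∸ 2) C j)
           R.* a ^ᴿ (k ℕ.+ j) R.* b ^ᴿ (N ℕ.∸ k ℕ.∸ 2 ℕ.* j ℕ.∸ 2) R.* c ^ᴿ (j ℕ.+ 1))
        * x ^ k)
    P-homo N@(suc M) = trans (*-congʳ (scalar-homo M)) (trans
      (P-expansion (φ a) (φ b) (φ c) (φ r₁) (φ r₂) (φ d)
        (root-homo root₁) (root-homo root₂) inverse-homo x M)
      (+-cong (*-congʳ (sym (^-homo a M))) (-‿cong (sumTo-cong M λ k k<M → sym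
        (inner-sum (N C k) k (N ℕ.∸ k) 2 (∸1≡suc-∸2 k<M) λ j → begin
          φ (c ^ᴿ (j ℕ.+ 1))     ≡⟨ cong (λ i → φ (c ^ᴿ i)) (ℕ.+-comm j 1) ⟩
          φ (c R.* c ^ᴿ j)       ≈⟨ trans (*-homo c _) (*-congˡ (^-homo c j)) ⟩
          φ c * φ c ^ j          ∎)))))

-- The embedding of the constants into the polynomials

module _ {c ℓ} (R : CommutativeRing c ℓ) where

  private
    module R = CommutativeRing R
    module R[X] = Polynomial R
  open R[X] using (mk≈)

  const-isRingHomomorphism :
    IsRingHomomorphism R.rawRing (CommutativeRing.rawRing R[X].commutativeRing) R[X].const
  const-isRingHomomorphism = record
    { isSemiringHomomorphism = record
      { isNearSemiringHomomorphism = record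
        { +-isMonoidHomomorphism = record
          { isMagmaHomomorphism = record
            { isRelHomomorphism = record
              { cong = λ x≈y → mk≈ λ { zero → x≈y ; (suc _) → R.refl } }
            ; homo = λ _ _ → mk≈ λ _ → R.refl
            }
          ; ε-homo = mk≈ λ { zero → R.refl ; (suc _) → R.refl }
          }
        -- The product of two constant polynomials is computed as x y + 0.
        ; *-homo = λ _ _ → mk≈ λ { zero → R.sym (R.+-identityʳ _) ; (suc _) → R.refl }
        }
      ; 1#-homo = mk≈ λ _ → R.refl
      }
    ; -‿homo = λ _ → mk≈ λ _ → R.refl
    }

-- Specialisation to ℂ and ℂ[X]

open import Defs

theorem1 :
  (a b c : ℂ) → a #0 → (b ^ 2 - fromℕ 4 * a * c) #0 →
  (r₁ r₂ : ℂ) → IsRoot a b c r₁ → IsRoot a b c r₂ → (r₁#r₂ : r₁ # r₂) →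
  (n : ℕ) →
  let N = 2 ℕ.^ n in
  ( P a r₁ r₂ r₁#r₂ n ≈ₚ
      const (a ^ (N ℕ.∸ 1)) *ₚ X ^ₚ N -ₚ
      (∑[ k < N ℕ.∸ 1 ] ∑[ j < N ℕ.∸ k ℕ.∸ 1 ]
        const ((- 1#) ^ j * fromℕ (N C k) * fromℕ ((N ℕ.∸ k ℕ.∸ j ℕ.∸ 2) C j)
               * a ^ (k ℕ.+ j) * b ^ (N ℕ.∸ k ℕ.∸ 2 ℕ.* j ℕ.∸ 2) * c ^ (j ℕ.+ 1))
        *ₚ X ^ₚ k) )
  ×
  ( Q a r₁ r₂ r₁#r₂ n ≈ₚ
      (∑[ k < N ] ∑[ j < N ℕ.∸ k ]
        const ((- 1#) ^ j * fromℕ (N C k) * fromℕ ((N ℕ.∸ k ℕ.∸ j ℕ.∸ 1) C j)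
               * a ^ (k ℕ.+ j) * b ^ (N ℕ.∸ k ℕ.∸ 2 ℕ.* j ℕ.∸ 1) * c ^ j)
        *ₚ X ^ₚ k) )
theorem1 a b c _ _ r₁ r₂ root₁ root₂ r₁#r₂ n =
    P-homo a b c r₁ r₂ d root₁ root₂ inverse X N
  , Q-homo a b c r₁ r₂ d root₁ root₂ inverse X N
  where
  open Homomorphic ℂ-commutativeRing ℂ[X]-commutativeRing
    (const-isRingHomomorphism ℂ-commutativeRing)
  N = 2 ℕ.^ n
  instance
    N≢0 : ℕ.NonZero N
    N≢0 = ℕ.m^n≢0 2 n
  -- The same reciprocal as in the definitions of `P` and `Q`, so their left sides agree by
  -- computation.
  d = recip (r₁ - r₂) r₁#r₂
  inverse = recip-inverse (r₁ - r₂) r₁#r₂
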